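{- For every integer $k\geq 2$, there exists an infinite strongly rotarily transitive connected graph with countably many vertices and diameter exactly $k$.
   Context: A graph is a pair $\mathcal{G}=(V,E)$ where $V$ is a set (of vertices) and $E$ (the edges) is a set of subsets of $V$ having exactly two elements. It is infinite if $V$ is infinite. A path of length $n\ge 0$ is a finite sequence of vertices $(v_0,\dots,v_n)$ such that $\{v_i,v_{i+1}\}\in E$ for all $i<n$; it connects $v_0$ and $v_n$. A graph is connected if any two vertices are connected by a path. The diameter of a connected graph is the smallest $k\in\mathbb{N}\cup\{\infty\}$ such that any two vertices are connected by a path of length at most $k$. An automorphism of $\mathcal{G}$ is a bijection $\varphi:V\to V$ such that for all $u,v\in V$, $\{u,v\}\in E \iff \{\varphi(u),\varphi(v)\}\in E$; these form the group $\mathrm{Aut}(\mathcal{G})$. A graph $\mathcal{G}$ is strongly rotarily transitive if the natural action of $\mathrm{Aut}(\mathcal{G})$ on $V$ is transitive and every element of $\mathrm{Aut}(\mathcal{G})$ (including the identity) fixes at least one vertex. -}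

module Defs where

open import Data.Fin using (Fin; suc; inject₁; fromℕ)
import Data.Fin as Fin
open import Data.Nat using (ℕ; suc; _≤_)
open import Data.Product using (_×_; ∃; ∃-syntax)
open import Function.Bundles using (_⇔_; _↣_; _⤖_; module Bijection)
open import Relation.Binary using (Rel; Symmetric; Irreflexive)
open import Relation.Binary.PropositionalEquality using (_≡_)
open import Level using (0ℓ)

-- A set of two-element subsets of V is encoded as a symmetric irreflexive
-- relation: E u v says that {u , v} is an edge.
record Graph : Set₁ where
  field
    V        : Set
    E        : Rel V 0ℓ
    E-sym    : Symmetric E
    E-irrefl : Irreflexive _≡_ E

module _ (G : Graph) where
  open Graph G

  -- Vertices may repeat; n counts edges, so a path of length 0 is one vertex.
  record Path (n : ℕ) (u v : V) : Set where
    field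
      vertex : Fin (suc n) → V
      edge   : ∀ (i : Fin n) → E (vertex (inject₁ i)) (vertex (suc i))
      start  : vertex Fin.zero ≡ u
      end    : vertex (fromℕ n) ≡ v

  Connected : Set
  Connected = ∀ u v → ∃[ n ] Path n u v

  ConnectedWithin : ℕ → Set
  ConnectedWithin k = ∀ u v → ∃[ n ] (n ≤ k × Path n u v)

  -- The diameter is the finite number k.
  HasDiameter : ℕ → Set
  HasDiameter k = ConnectedWithin k × (∀ m → ConnectedWithin m → k ≤ m)

  record Automorphism : Set where
    field
      bijection : V ⤖ V
    open Bijection bijection public using (to)
    field
      preserves : ∀ u v → E u v ⇔ E (to u) (to v)

  VertexTransitive : Set
  VertexTransitive = ∀ u v → ∃ λ (φ : Automorphism) → Automorphism.to φ u ≡ v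

  -- The identity of an inhabited graph fixes a vertex trivially; the condition
  -- excludes the empty graph.
  StronglyRotarilyTransitive : Set
  StronglyRotarilyTransitive =
    VertexTransitive ×
    (∀ (φ : Automorphism) → ∃[ v ] Automorphism.to φ v ≡ v)

  InfiniteGraph : Set
  InfiniteGraph = ℕ ↣ V

  CountablyManyVertices : Set
  CountablyManyVertices = V ↣ ℕ

-- A vertex is a k-tuple of points; a point is a finitely supported sequence of
-- levels, and a level is a finitely supported sequence of integers.  Deleting the
-- first entry of level n while adding 1 to the first entry of level n + 1 (levels
-- below n become arbitrary) is written Step n x y, and x ⟶ y if this holds for
-- some n.  Points are homogeneous: adding W m to level n, where m is the first
-- entry of level n + 1, preserves all steps if W (m + 1) is W m without its first
-- entry.  Every bijection ψ preserving all Step n fixes a point: choose x such that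
-- ψ x and x agree from level n + 1 on; repeated steps at level n delete all entries
-- in which x and ψ x differ at level n, leading to x′ such that ψ x′ and x′ agree
-- from level n on; descend to level 0.
--
-- Two tuples are adjacent if they differ in exactly one coordinate (line edge), or if
-- one coordinate makes a step x ⟶ y and 1 is added to the first entry of level 0 in
-- all other coordinates (diagonal edge).  Above level 0 every edge changes just one
-- coordinate, so the diameter is k.  An automorphism preserves the line edges, which
-- are recognised by their common neighbours, hence it permutes the coordinates and acts
-- on each of them; these actions preserve ⟶ (reversing it is impossible) and
-- therefore every Step n, because the parents under ⟶ determine their levels.

module Submission where

open import Defs
open import Data.Nat using (ℕ; zero; suc; _≤_; _<_; z≤n; s≤s; _⊔_)
import Data.Nat.Properties as ℕ
open import Data.Nat.Binary using (ℕᵇ; 2[1+_]; 1+[2_]) renaming (toℕ to toℕᵇ; zero to 0ᵇ)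
import Data.Nat.Binary.Properties as ℕᵇ
open import Data.Integer using (ℤ; +_; -[1+_]; 0ℤ; 1ℤ; -1ℤ)
import Data.Integer as ℤ
import Data.Integer.Properties as ℤ
open import Algebra.Properties.AbelianGroup ℤ.+-0-abelianGroup using () renaming (∙-cancelʳ to ℤ-cancelʳ)
open import Data.Fin using (Fin; zero; suc; inject₁; fromℕ)
import Data.Fin.Properties as Fin
open import Data.Vec using (Vec; []; _∷_; lookup; tabulate; replicate; _[_]≔_)
import Data.Vec.Properties as Vec
open import Data.Product using (Σ; _×_; _,_; proj₁; proj₂; ∃)
open import Data.Sum using (_⊎_; inj₁; inj₂; [_,_]′)
open import Data.Empty using (⊥; ⊥-elim; ⊥-elim-irr)
open import Function using (id; _∘_)
open import Function.Bundles using (_↣_; mk↣; mk⇔; mk⤖; Equivalence; Bijection)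
open import Relation.Binary.Definitions using (DecidableEquality; tri<; tri≈; tri>)
open import Relation.Nullary using (¬_; Dec; yes; no; contradiction)
open import Relation.Binary.PropositionalEquality
  using (_≡_; _≢_; refl; sym; trans; cong; cong₂; subst; subst₂; ≢-sym)

-- Finitely supported sequences

module FinitelySupported {A : Set} (0# : A) (0#? : ∀ a → Dec (a ≡ 0#)) where

  -- The proof in `last` is irrelevant, so that supports with the same entries are equal.
  data Support : Set where
    last : (a : A) → .(a ≢ 0#) → Support
    _∷_  : A → Support → Support

  -- A sequence is stored up to its last nonzero entry, so that pointwise equal
  -- sequences are equal.
  data FinSupp : Set where
    𝟎 : FinSupp
    nz : Support → FinSupp

  at : FinSupp → ℕ → A
  at 𝟎               n       = 0#
  at (nz (last a _)) zero    = a
  at (nz (last a _)) (suc n) = 0#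
  at (nz (a ∷ x))    zero    = a
  at (nz (a ∷ x))    (suc n) = at (nz x) n

  head : FinSupp → A
  head x = at x 0

  tail : FinSupp → FinSupp
  tail 𝟎               = 𝟎
  tail (nz (last a _)) = 𝟎
  tail (nz (a ∷ x))    = nz x

  cons : A → FinSupp → FinSupp
  cons a (nz x) = nz (a ∷ x)
  cons a 𝟎 with 0#? a
  ... | yes _   = 𝟎
  ... | no  a≢0 = nz (last a a≢0)

  at-tail : ∀ x n → at (tail x) n ≡ at x (suc n)
  at-tail 𝟎               n = refl
  at-tail (nz (last a _)) n = refl
  at-tail (nz (a ∷ x))    n = refl

  head-cons : ∀ a x → head (cons a x) ≡ a
  head-cons a (nz x) = refl
  head-cons a 𝟎 with 0#? a
  ... | yes a≡0 = sym a≡0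
  ... | no  _   = refl

  tail-cons : ∀ a x → tail (cons a x) ≡ x
  tail-cons a (nz x) = refl
  tail-cons a 𝟎 with 0#? a
  ... | yes _ = refl
  ... | no  _ = refl

  at-cons : ∀ a x n → at (cons a x) (suc n) ≡ at x n
  at-cons a x n =
    trans (sym (at-tail (cons a x) n)) (cong (λ y → at y n) (tail-cons a x))

  at-nonzero : ∀ x → ∃ λ n → at (nz x) n ≢ 0#
  at-nonzero (last a a≢0) = 0 , λ a≡0 → ⊥-elim-irr (a≢0 a≡0)
  at-nonzero (a ∷ x) with at-nonzero x
  ... | n , p = suc n , p

  ext : ∀ x y → (∀ n → at x n ≡ at y n) → x ≡ y
  ext 𝟎 𝟎 eq = refl
  ext 𝟎 (nz y) eq with at-nonzero y
  ... | n , p = contradiction (sym (eq n)) p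
  ext (nz x) 𝟎 eq with at-nonzero x
  ... | n , p = contradiction (eq n) p
  ext (nz (last a p)) (nz (last b q)) eq with refl ← eq 0 = refl
  ext (nz (last a p)) (nz (b ∷ y)) eq with at-nonzero y
  ... | n , q = contradiction (sym (eq (suc n))) q
  ext (nz (a ∷ x)) (nz (last b q)) eq with at-nonzero x
  ... | n , p = contradiction (eq (suc n)) p
  ext (nz (a ∷ x)) (nz (b ∷ y)) eq
    with refl ← eq 0 | refl ← ext (nz x) (nz y) (λ n → eq (suc n)) = refl

  finite : ∀ x → ∃ λ b → ∀ n → b ≤ n → at x n ≡ 0#
  finite 𝟎 = 0 , λ _ _ → refl
  finite (nz (last a _)) = 1 , λ where (suc n) _ → refl
  finite (nz (a ∷ x)) with finite (nz x)
  ... | b , p = suc b , λ where (suc n) (s≤s b≤n) → p n b≤n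

  𝟎? : ∀ x → Dec (x ≡ 𝟎)
  𝟎? 𝟎      = yes refl
  𝟎? (nz x) = no λ ()

  module _ (_≟_ : DecidableEquality A) where

    Support-≟ : DecidableEquality Support
    Support-≟ (last a _) (last b _) with a ≟ b
    ... | yes refl = yes refl
    ... | no  a≢b  = no λ { refl → a≢b refl }
    Support-≟ (last _ _) (_ ∷ _)    = no λ ()
    Support-≟ (_ ∷ _)    (last _ _) = no λ ()
    Support-≟ (a ∷ x)    (b ∷ y) with a ≟ b | Support-≟ x y
    ... | yes refl | yes refl = yes refl
    ... | no  a≢b  | _        = no λ { refl → a≢b refl }
    ... | _        | no x≢y   = no λ { refl → x≢y refl }

    FinSupp-≟ : DecidableEquality FinSupp
    FinSupp-≟ 𝟎      𝟎      = yes refl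
    FinSupp-≟ 𝟎      (nz _) = no λ ()
    FinSupp-≟ (nz _) 𝟎      = no λ ()
    FinSupp-≟ (nz x) (nz y) with Support-≟ x y
    ... | yes refl = yes refl
    ... | no x≢y   = no λ { refl → x≢y refl }

  infixl 6 _[_≔_]

  abstract
    _[_≔_] : FinSupp → ℕ → A → FinSupp
    x [ zero  ≔ a ] = cons a (tail x)
    x [ suc n ≔ a ] = cons (head x) (tail x [ n ≔ a ])

    at-≔ : ∀ x n a → at (x [ n ≔ a ]) n ≡ a
    at-≔ x zero    a = head-cons a (tail x)
    at-≔ x (suc n) a = trans (at-cons (head x) (tail x [ n ≔ a ]) n) (at-≔ (tail x) n a)

    at-≔′ : ∀ x n a m → m ≢ n → at (x [ n ≔ a ]) m ≡ at x m
    at-≔′ x zero    a zero    m≢n = contradiction refl m≢n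
    at-≔′ x zero    a (suc m) m≢n = trans (at-cons a (tail x) m) (at-tail x m)
    at-≔′ x (suc n) a zero    m≢n = head-cons (head x) (tail x [ n ≔ a ])
    at-≔′ x (suc n) a (suc m) m≢n =
      trans (at-cons (head x) (tail x [ n ≔ a ]) m)
        (trans (at-≔′ (tail x) n a m (m≢n ∘ cong suc)) (at-tail x m))

-- Prefix codes

-- Codes that can be read off the front of a binary numeral.
PrefixCode : Set → Set
PrefixCode A = Σ (A → ℕᵇ → ℕᵇ) λ c →
  ∀ a b r s → c a r ≡ c b s → a ≡ b × r ≡ s

code⇒↣ : ∀ {A} → PrefixCode A → A ↣ ℕ
code⇒↣ (c , inj) = mk↣ {to = λ a → toℕᵇ (c a 0ᵇ)}
  λ {a} {b} eq → proj₁ (inj a b 0ᵇ 0ᵇ (ℕᵇ.toℕ-injective eq))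

1+[2]-injective : ∀ {x y} → 1+[2 x ] ≡ 1+[2 y ] → x ≡ y
1+[2]-injective refl = refl

2[1+]-injective : ∀ {x y} → 2[1+ x ] ≡ 2[1+ y ] → x ≡ y
2[1+]-injective refl = refl

-- Unary notation: one digit of `ℕᵇ` for each successor, the other digit as terminator.
ℕ-code : PrefixCode ℕ
ℕ-code = c , inj
  where
  c : ℕ → ℕᵇ → ℕᵇ
  c zero    r = 2[1+ r ]
  c (suc n) r = 1+[2 c n r ]

  inj : ∀ a b r s → c a r ≡ c b s → a ≡ b × r ≡ s
  inj zero    zero    r s eq = refl , 2[1+]-injective eq
  inj (suc a) (suc b) r s eq with inj a b r s (1+[2]-injective eq)
  ... | refl , eq′ = refl , eq′

ℤ-code : PrefixCode ℤ
ℤ-code = c , inj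
  where
  c : ℤ → ℕᵇ → ℕᵇ
  c (+ n)      r = 2[1+ proj₁ ℕ-code n r ]
  c (-[1+ n ]) r = 1+[2 proj₁ ℕ-code n r ]

  inj : ∀ a b r s → c a r ≡ c b s → a ≡ b × r ≡ s
  inj (+ a) (+ b) r s eq with proj₂ ℕ-code a b r s (2[1+]-injective eq)
  ... | refl , eq′ = refl , eq′
  inj (-[1+ a ]) (-[1+ b ]) r s eq with proj₂ ℕ-code a b r s (1+[2]-injective eq)
  ... | refl , eq′ = refl , eq′

Vec-code : ∀ {A} n → PrefixCode A → PrefixCode (Vec A n)
Vec-code {A} n (cA , injA) = c , inj
  where
  c : ∀ {n} → Vec A n → ℕᵇ → ℕᵇ
  c []       r = r
  c (a ∷ as) r = cA a (c as r)

  inj : ∀ {n} (as bs : Vec A n) r s → c as r ≡ c bs s → as ≡ bs × r ≡ s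
  inj []       []       r s eq = refl , eq
  inj (a ∷ as) (b ∷ bs) r s eq with injA a b _ _ eq
  ... | refl , eq′ with inj as bs r s eq′
  ... | refl , eq″ = refl , eq″

module _ {A : Set} {0# : A} {0#? : ∀ a → Dec (a ≡ 0#)} where
  open FinitelySupported 0# 0#?

  -- The digit in front of each entry tells whether it is the last one.
  FinSupp-code : PrefixCode A → PrefixCode FinSupp
  FinSupp-code (cA , injA) = c , inj
    where
    c₊ : Support → ℕᵇ → ℕᵇ
    c₊ (last a _) r = 2[1+ cA a r ]
    c₊ (a ∷ x)    r = 1+[2 cA a (c₊ x r) ]

    inj₊ : ∀ x y r s → c₊ x r ≡ c₊ y s → x ≡ y × r ≡ s
    inj₊ (last a _) (last b _) r s eq with injA a b r s (2[1+]-injective eq)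
    ... | refl , eq′ = refl , eq′
    inj₊ (a ∷ x) (b ∷ y) r s eq with injA a b _ _ (1+[2]-injective eq)
    ... | refl , eq′ with inj₊ x y r s eq′
    ... | refl , eq″ = refl , eq″

    c : FinSupp → ℕᵇ → ℕᵇ
    c 𝟎      r = 2[1+ r ]
    c (nz x) r = 1+[2 c₊ x r ]

    inj : ∀ x y r s → c x r ≡ c y s → x ≡ y × r ≡ s
    inj 𝟎      𝟎      r s eq = refl , 2[1+]-injective eq
    inj (nz x) (nz y) r s eq with inj₊ x y r s (1+[2]-injective eq)
    ... | refl , eq′ = refl , eq′

-- Levels as sequences of integers

module ℤFinSupp = FinitelySupported 0ℤ (ℤ._≟ 0ℤ)

open ℤFinSupp using ()
  renaming (FinSupp to T; 𝟎 to 0ᵀ; nz to nzᵀ; _∷_ to _∷ᵀ_; last to lastᵀ; tail to σ; head to k; cons to consᵀ; at to atᵀ)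

abstract
  bump : ℤ → T → T
  bump m t = consᵀ (m ℤ.+ k t) (σ t)

  k-bump : ∀ m t → k (bump m t) ≡ m ℤ.+ k t
  k-bump m t = ℤFinSupp.head-cons _ (σ t)

  σ-bump : ∀ m t → σ (bump m t) ≡ σ t
  σ-bump m t = ℤFinSupp.tail-cons _ (σ t)

S S⁻ : T → T
S  = bump 1ℤ
S⁻ = bump -1ℤ

T-ext : ∀ {s t} → k s ≡ k t → σ s ≡ σ t → s ≡ t
T-ext {s} {t} p q = ℤFinSupp.ext s t λ where
  zero    → p
  (suc i) → trans (sym (ℤFinSupp.at-tail s i))
              (trans (cong (λ u → atᵀ u i) q) (ℤFinSupp.at-tail t i))

bump-bump : ∀ m n t → bump m (bump n t) ≡ bump (m ℤ.+ n) t
bump-bump m n t = T-ext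
  (trans (k-bump m (bump n t))
    (trans (cong (ℤ._+_ m) (k-bump n t))
      (trans (sym (ℤ.+-assoc m n (k t))) (sym (k-bump (m ℤ.+ n) t)))))
  (trans (σ-bump m (bump n t)) (trans (σ-bump n t) (sym (σ-bump (m ℤ.+ n) t))))

bump-0 : ∀ t → bump 0ℤ t ≡ t
bump-0 t = T-ext (trans (k-bump 0ℤ t) (ℤ.+-identityˡ (k t))) (σ-bump 0ℤ t)

bump-injective : ∀ {m n} t → bump m t ≡ bump n t → m ≡ n
bump-injective {m} {n} t eq = ℤ-cancelʳ (k t) m n
  (trans (sym (k-bump m t)) (trans (cong k eq) (k-bump n t)))

bump≢ : ∀ m t → m ≢ 0ℤ → bump m t ≢ t
bump≢ m t m≢0 eq = m≢0 (bump-injective t (trans eq (sym (bump-0 t))))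

S≢ : ∀ {t} → S t ≢ t
S≢ {t} = bump≢ 1ℤ t λ ()

SS≢ : ∀ {t} → S (S t) ≢ t
SS≢ {t} = bump≢ (+ 2) t (λ ()) ∘ trans (sym (bump-bump 1ℤ 1ℤ t))

SSS≢ : ∀ {t} → S (S (S t)) ≢ t
SSS≢ {t} = bump≢ (+ 3) t (λ ()) ∘ trans
  (sym (trans (cong S (bump-bump 1ℤ 1ℤ t)) (bump-bump 1ℤ (+ 2) t)))

S-S⁻ : ∀ t → S (S⁻ t) ≡ t
S-S⁻ t = trans (bump-bump 1ℤ -1ℤ t) (bump-0 t)

-- Points, steps and their levels

module Levels = FinitelySupported 0ᵀ ℤFinSupp.𝟎?

open Levels using (_[_≔_])
  renaming (FinSupp to V; 𝟎 to 0ⱽ; at to infixl 9 _!_; ext to V-ext)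

_≟ⱽ_ : DecidableEquality V
_≟ⱽ_ = Levels.FinSupp-≟ (ℤFinSupp.FinSupp-≟ ℤ._≟_)

record Agree (n : ℕ) (x y : V) : Set where
  constructor agree
  field on : ∀ {l} → n ≤ l → x ! l ≡ y ! l

open Agree

Agree-refl : ∀ {n x} → Agree n x x
Agree-refl = agree λ _ → refl

Agree-sym : ∀ {n x y} → Agree n x y → Agree n y x
Agree-sym e = agree λ n≤l → sym (e .on n≤l)

Agree-trans : ∀ {n x y z} → Agree n x y → Agree n y z → Agree n x z
Agree-trans e f = agree λ n≤l → trans (e .on n≤l) (f .on n≤l)

Agree-mono : ∀ {m n x y} → m ≤ n → Agree m x y → Agree n x y
Agree-mono m≤n e = agree λ n≤l → e .on (ℕ.≤-trans m≤n n≤l)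

Agree-0 : ∀ {x y} → Agree 0 x y → x ≡ y
Agree-0 {x} {y} e = V-ext x y λ _ → e .on z≤n

Agree-≔ : ∀ x n a → Agree (suc n) (x [ n ≔ a ]) x
Agree-≔ x n a = agree λ n<l → Levels.at-≔′ x n a _ (ℕ.>⇒≢ n<l)

-- Both points vanish beyond their supports. This supplies the level at which the downward
-- inductions start.
eventually-agree : ∀ x y → ∃ λ n → Agree n x y
eventually-agree x y with Levels.finite x | Levels.finite y
... | m , p | n , q = m ⊔ n , agree λ {l} b →
  trans (p l (ℕ.≤-trans (ℕ.m≤m⊔n m n) b)) (sym (q l (ℕ.≤-trans (ℕ.m≤n⊔m m n) b)))

-- The levels of y below n are arbitrary, so this is a relation between the tails of x
-- and y from level n on; these tails form a forest with y as the parent of x.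
record Step (n : ℕ) (x y : V) : Set where
  field
    low  : y ! n ≡ σ (x ! n)
    mid  : y ! suc n ≡ S (x ! suc n)
    high : Agree (suc (suc n)) y x

open Step

infix 4 _⟶_

_⟶_ : V → V → Set
x ⟶ y = ∃ λ n → Step n x y

Step-respˡ : ∀ {n x x′ y} → Agree n x x′ → Step n x y → Step n x′ y
Step-respˡ e p .low  = trans (p .low) (cong σ (e .on ℕ.≤-refl))
Step-respˡ e p .mid  = trans (p .mid) (cong S (e .on (ℕ.n≤1+n _)))
Step-respˡ e p .high = Agree-trans (p .high) (Agree-mono (ℕ.m≤n+m _ 2) e)

Step-respʳ : ∀ {n x y y′} → Agree n y y′ → Step n x y → Step n x y′
Step-respʳ e p .low  = trans (sym (e .on ℕ.≤-refl)) (p .low)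
Step-respʳ e p .mid  = trans (sym (e .on (ℕ.n≤1+n _))) (p .mid)
Step-respʳ e p .high = Agree-trans (Agree-mono (ℕ.m≤n+m _ 2) (Agree-sym e)) (p .high)

-- Levels below `n` are kept; `down` restores the deleted entry as 0, one of many possible choices.
up down : ℕ → V → V
up   n x = x [ suc n ≔ S  (x ! suc n) ] [ n ≔ σ (x ! n) ]
down n y = y [ suc n ≔ S⁻ (y ! suc n) ] [ n ≔ consᵀ 0ℤ (y ! n) ]

up-Step : ∀ n x → Step n x (up n x)
up-Step n x .low  = Levels.at-≔ (x [ suc n ≔ _ ]) n _
up-Step n x .mid  = trans (Agree-≔ _ n _ .on ℕ.≤-refl) (Levels.at-≔ x (suc n) _)
up-Step n x .high = agree λ h → trans (Agree-≔ _ n _ .on (ℕ.<⇒≤ h)) (Agree-≔ x (suc n) _ .on h)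

down-Step : ∀ n y → Step n (down n y) y
down-Step n y .low = sym (trans (cong σ (Levels.at-≔ (y [ suc n ≔ _ ]) n _))
                                (ℤFinSupp.tail-cons 0ℤ (y ! n)))
down-Step n y .mid = sym (trans (cong S (trans (Agree-≔ _ n _ .on ℕ.≤-refl) (Levels.at-≔ y (suc n) _)))
                                (S-S⁻ _))
down-Step n y .high = agree λ h → sym (trans (Agree-≔ _ n _ .on (ℕ.<⇒≤ h)) (Agree-≔ y (suc n) _ .on h))

-- Level `suc n` is bumped, and it is never level 0. Steps are thereby told apart from slides, which
-- change level 0 only.
⟶-disagree : ∀ {x y} → x ⟶ y → ¬ Agree 1 x y
⟶-disagree (n , p) e = S≢ (trans (sym (p .mid)) (sym (e .on (s≤s z≤n))))

⟶-irrefl : ∀ {x} → ¬ (x ⟶ x)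
⟶-irrefl p = ⟶-disagree p Agree-refl

-- At the highest level that either step bumps, the increments add up to 1 or 2 and cannot cancel.
⟶-asym : ∀ {x y} → x ⟶ y → ¬ (y ⟶ x)
⟶-asym (n , p) (m , q) with ℕ.<-cmp n m
... | tri< n<m _ _ = S≢ (trans (sym (q .mid)) (sym (p .high .on (s≤s n<m))))
... | tri≈ _ refl _ = SS≢ (trans (cong S (sym (p .mid))) (sym (q .mid)))
... | tri> _ _ m<n = S≢ (trans (sym (p .mid)) (sym (q .high .on (s≤s m<n))))

Step-unique : ∀ {m n x y} → Step n x y → Step m x y → ¬ (n < m)
Step-unique p q n<m = S≢ (trans (sym (q .mid)) (p .high .on (s≤s n<m)))

-- The parents of x at level n come first: every parent of x at a higher level is
-- also a parent of theirs.
Step-lift : ∀ {m n x y z} → n < m → Step n x z → Step m x y → Step m z y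
Step-lift {suc m} {n} {x} {y} {z} (s≤s n≤m) p q = go (ℕ.m≤n⇒m<n∨m≡n n≤m)
  where
  go : n < m ⊎ n ≡ m → Step (suc m) z y
  go (inj₁ n<m) = Step-respˡ (Agree-mono (s≤s n<m) (Agree-sym (p .high))) q
  -- Here `z` and `x` differ at level `suc m` only in the first entry, which the higher step
  -- deletes.
  go (inj₂ refl) = record
    { low  = trans (q .low) (sym (trans (cong σ (p .mid)) (σ-bump 1ℤ _)))
    ; mid  = trans (q .mid) (cong S (sym (p .high .on ℕ.≤-refl)))
    ; high = Agree-trans (q .high) (Agree-mono (ℕ.n≤1+n _) (Agree-sym (p .high)))
    }

-- Two steps at levels at least `n` either bump a level above `suc n`, where `x` and `y` agree, or
-- bump level `suc n` twice, where `x` and `y` are one bump apart.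
Step-indecomposable : ∀ {n p q x y z} → n ≤ p → n ≤ q →
  Step n x y → Step p x z → ¬ Step q z y
Step-indecomposable {n} {p} {q} n≤p n≤q a b c with ℕ.<-cmp p q
... | tri< p<q _ _ = S≢ (trans (sym (trans (c .mid) (cong S (b .high .on (s≤s p<q)))))
                         (a .high .on (s≤s (ℕ.≤-<-trans n≤p p<q))))
... | tri> _ _ q<p = S≢ (trans (sym (trans (c .high .on (s≤s q<p)) (b .mid)))
                         (a .high .on (s≤s (ℕ.≤-<-trans n≤q q<p))))
... | tri≈ _ refl _ with ℕ.m≤n⇒m<n∨m≡n n≤p
...   | inj₁ n<p = SS≢ (trans (sym (trans (c .mid) (cong S (b .mid)))) (a .high .on (s≤s n<p)))
...   | inj₂ refl = S≢ (trans (sym (trans (c .mid) (cong S (b .mid)))) (a .mid))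

Step≥ : ℕ → V → V → Set
Step≥ n x y = ∃ λ m → n ≤ m × Step m x y

-- By `Step-lift` a step at a higher level splits at `up n x`. Level `n` is thus recognised, among
-- the levels from `n` on, by the steps that do not split.
Step≥-indecomposable⇒Step : ∀ {n x y} → Step≥ n x y →
  (∀ z → Step≥ n x z → ¬ Step≥ n z y) → Step n x y
Step≥-indecomposable⇒Step {n} {x} (m , n≤m , p) indec with ℕ.m≤n⇒m<n∨m≡n n≤m
... | inj₂ refl = p
... | inj₁ n<m  = ⊥-elim (indec (up n x) (n , ℕ.≤-refl , up-Step n x)
                                (m , n≤m , Step-lift n<m (up-Step n x) p))

-- Bijections of points that preserve steps

module _ (ψ ψ⁻ : V → V) (ψψ⁻ : ∀ x → ψ (ψ⁻ x) ≡ x) where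

  module _ (preserves : ∀ {x y} → x ⟶ y → ψ x ⟶ ψ y)
           (reflects  : ∀ {x y} → ψ x ⟶ ψ y → x ⟶ y) where

    private
      Level : ℕ → Set
      Level n = (∀ {x y} → Step≥ n x y → Step≥ n (ψ x) (ψ y)) ×
                (∀ {x y} → Step≥ n (ψ x) (ψ y) → Step≥ n x y)

      -- A splitting of the image step would pull back along `ψ⁻` to one of the given step.
      exact→ : ∀ {n} → Level n → ∀ {x y} → Step n x y → Step n (ψ x) (ψ y)
      exact→ {n} (pres , refls) {x} {y} p =
        Step≥-indecomposable⇒Step (pres (n , ℕ.≤-refl , p)) indec
        where
        indec : ∀ z → Step≥ n (ψ x) z → ¬ Step≥ n z (ψ y)
        indec z a b
          with q , n≤q , a′ ← refls (subst (Step≥ n (ψ x)) (sym (ψψ⁻ z)) a)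
             | r , n≤r , b′ ← refls (subst (λ z → Step≥ n z (ψ y)) (sym (ψψ⁻ z)) b)
             = Step-indecomposable n≤q n≤r p a′ b′

      exact← : ∀ {n} → Level n → ∀ {x y} → Step n (ψ x) (ψ y) → Step n x y
      exact← {n} (pres , refls) {x} {y} p =
        Step≥-indecomposable⇒Step (refls (n , ℕ.≤-refl , p)) indec
        where
        indec : ∀ z → Step≥ n x z → ¬ Step≥ n z y
        indec z a b with q , n≤q , a′ ← pres a | r , n≤r , b′ ← pres b
          = Step-indecomposable n≤q n≤r p a′ b′

      -- Steps of level exactly `n` correspond by `exact→` and `exact←`; discarding them on both
      -- sides passes from `n` to `suc n`.
      level : ∀ n → Level n
      level zero =
        (λ (m , _ , p) → let n , q = preserves (m , p) in n , z≤n , q) ,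
        (λ (m , _ , p) → let n , q = reflects (m , p) in n , z≤n , q)
      level (suc n) = pres , refls
        where
        pres : ∀ {x y} → Step≥ (suc n) x y → Step≥ (suc n) (ψ x) (ψ y)
        pres (m , n<m , p) with proj₁ (level n) (m , ℕ.<⇒≤ n<m , p)
        ... | l , n≤l , q with ℕ.m≤n⇒m<n∨m≡n n≤l
        ... | inj₁ n<l  = l , n<l , q
        ... | inj₂ refl = ⊥-elim (Step-unique (exact← (level n) q) p n<m)

        refls : ∀ {x y} → Step≥ (suc n) (ψ x) (ψ y) → Step≥ (suc n) x y
        refls (m , n<m , p) with proj₂ (level n) (m , ℕ.<⇒≤ n<m , p)
        ... | l , n≤l , q with ℕ.m≤n⇒m<n∨m≡n n≤l
        ... | inj₁ n<l  = l , n<l , q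
        ... | inj₂ refl = ⊥-elim (Step-unique (exact→ (level n) q) p n<m)

    preserves-Step : ∀ n {x y} → Step n x y → Step n (ψ x) (ψ y)
    preserves-Step n = exact→ (level n)

  -- The first parent y of x lies below all other parents of x, but among the
  -- children of a vertex none lies above all others.
  not-reversing : (∀ {x y} → x ⟶ y → ψ y ⟶ ψ x) → ¬ (∀ {x y} → ψ x ⟶ ψ y → y ⟶ x)
  not-reversing reverses reflects = contra (reverses (0 , up-Step 0 0ⱽ))
    where
    y = up 0 0ⱽ

    above : ∀ {z} → 0ⱽ ⟶ z → z ≡ y ⊎ y ⟶ z
    above (suc m , p) = inj₂ (suc m , Step-lift (s≤s z≤n) (up-Step 0 0ⱽ) p)
    above {z} (zero , p) = inj₁ (V-ext z y level)
      where
      level : ∀ l → z ! l ≡ y ! l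
      level zero          = trans (p .low) (sym (up-Step 0 0ⱽ .low))
      level (suc zero)    = trans (p .mid) (sym (up-Step 0 0ⱽ .mid))
      level (suc (suc l)) =
        trans (p .high .on (s≤s (s≤s z≤n))) (sym (up-Step 0 0ⱽ .high .on (s≤s (s≤s z≤n))))

    contra : ¬ (ψ y ⟶ ψ 0ⱽ)
    contra (m , p) with above (reflects (subst (_⟶ ψ 0ⱽ) (sym (ψψ⁻ sibling)) (m , child)))
      where
      -- The step from `ψ y` to `ψ 0ⱽ` deletes the first entry of level `m`, so changing this entry
      -- yields another child of `ψ 0ⱽ`.
      sibling = ψ y [ m ≔ S (ψ y ! m) ]

      child : Step m sibling (ψ 0ⱽ)
      child .low    = trans (p .low) (sym (trans (cong σ (Levels.at-≔ (ψ y) m _)) (σ-bump 1ℤ _)))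
      child .mid    = trans (p .mid) (cong S (sym (Agree-≔ (ψ y) m _ .on ℕ.≤-refl)))
      child .high = agree λ h → trans (p .high .on h) (sym (Agree-≔ (ψ y) m _ .on (ℕ.<⇒≤ h)))
    ... | inj₁ e = S≢ (trans (sym (Levels.at-≔ (ψ y) m _)) (cong (_! m) (trans (sym (ψψ⁻ _)) (cong ψ e))))
    -- By reversal `sibling` would be a child of `ψ y`. A step raises the topmost level that it
    -- changes, but here that level is `m`, and it would fall.
    ... | inj₂ y⟶z with l , q ← subst (_⟶ ψ y) (ψψ⁻ _) (reverses y⟶z) | ℕ.<-cmp (suc l) m
    ... | tri< l<m _ _ = S≢ (sym (trans (q .high .on l<m) (Levels.at-≔ (ψ y) m _)))
    ... | tri≈ _ refl _ = SS≢ (sym (trans (q .mid) (cong S (Levels.at-≔ (ψ y) m _))))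
    ... | tri> _ _ m<l = S≢ (sym (trans (q .mid) (cong S (Agree-≔ (ψ y) m _ .on m<l))))

-- Slides of level 0

abstract
  slide : ℤ → V → V
  slide m x = x [ 0 ≔ bump m (x ! 0) ]

  slide-0 : ∀ m x → slide m x ! 0 ≡ bump m (x ! 0)
  slide-0 m x = Levels.at-≔ x 0 _

  slide-agree : ∀ m x → Agree 1 (slide m x) x
  slide-agree m x = Agree-≔ x 0 _

s s⁻ : V → V
s  = slide 1ℤ
s⁻ = slide -1ℤ

V-≡ : ∀ {x y} → x ! 0 ≡ y ! 0 → Agree 1 x y → x ≡ y
V-≡ {x} {y} p q = V-ext x y level
  where
  level : ∀ l → x ! l ≡ y ! l
  level zero    = p
  level (suc l) = q .on (s≤s z≤n)

slide-slide : ∀ m n x → slide m (slide n x) ≡ slide (m ℤ.+ n) x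
slide-slide m n x = V-≡
  (trans (slide-0 m (slide n x)) (trans (cong (bump m) (slide-0 n x))
    (trans (bump-bump m n (x ! 0)) (sym (slide-0 (m ℤ.+ n) x)))))
  (Agree-trans (slide-agree m (slide n x)) (Agree-trans (slide-agree n x) (Agree-sym (slide-agree (m ℤ.+ n) x))))

slide-zero : ∀ x → slide 0ℤ x ≡ x
slide-zero x = V-≡ (trans (slide-0 0ℤ x) (bump-0 _)) (slide-agree 0ℤ x)

slide-injective : ∀ m n x → slide m x ≡ slide n x → m ≡ n
slide-injective m n x e = bump-injective (x ! 0)
  (trans (sym (slide-0 m x)) (trans (cong (_! 0) e) (slide-0 n x)))

s⁻-s : ∀ x → s⁻ (s x) ≡ x
s⁻-s x = trans (slide-slide -1ℤ 1ℤ x) (slide-zero x)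

s-injective : ∀ {x y} → s x ≡ s y → x ≡ y
s-injective e = trans (sym (s⁻-s _)) (trans (cong s⁻ e) (s⁻-s _))

s≢ : ∀ {x} → s x ≢ x
s≢ {x} e with () ← slide-injective 1ℤ 0ℤ x (trans e (sym (slide-zero x)))

ss≢ : ∀ {x} → s (s x) ≢ x
ss≢ {x} e with () ← slide-injective (+ 2) 0ℤ x
                      (trans (sym (slide-slide 1ℤ 1ℤ x)) (trans e (sym (slide-zero x))))

sss≢ : ∀ {x} → s (s (s x)) ≢ x
sss≢ {x} e with () ← slide-injective (+ 3) 0ℤ x
  (trans (sym (trans (cong s (slide-slide 1ℤ 1ℤ x)) (slide-slide 1ℤ (+ 2) x)))
         (trans e (sym (slide-zero x))))

s-agree : ∀ {x y} → y ≡ s x → Agree 1 x y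
s-agree {x} refl = Agree-sym (slide-agree 1ℤ x)

-- Addition of levels and homogeneity of points

infixl 6 _⊕_

abstract
  _⊕_ : T → T → T
  t ⊕ 0ᵀ              = t
  t ⊕ nzᵀ (lastᵀ b _) = consᵀ (k t ℤ.+ b) (σ t)
  t ⊕ nzᵀ (b ∷ᵀ d)    = consᵀ (k t ℤ.+ b) (σ t ⊕ nzᵀ d)

  ⊖_ : T → T
  ⊖ 0ᵀ              = 0ᵀ
  ⊖ nzᵀ (lastᵀ b _) = consᵀ (ℤ.- b) 0ᵀ
  ⊖ nzᵀ (b ∷ᵀ d)    = consᵀ (ℤ.- b) (⊖ nzᵀ d)

  at-⊕ : ∀ t d i → atᵀ (t ⊕ d) i ≡ atᵀ t i ℤ.+ atᵀ d i
  at-⊕ t 0ᵀ              i       = sym (ℤ.+-identityʳ _)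
  at-⊕ t (nzᵀ (lastᵀ b _)) zero    = ℤFinSupp.head-cons _ (σ t)
  at-⊕ t (nzᵀ (lastᵀ b _)) (suc i) =
    trans (ℤFinSupp.at-cons _ (σ t) i) (trans (ℤFinSupp.at-tail t i) (sym (ℤ.+-identityʳ _)))
  at-⊕ t (nzᵀ (b ∷ᵀ d))    zero    = ℤFinSupp.head-cons _ (σ t ⊕ nzᵀ d)
  at-⊕ t (nzᵀ (b ∷ᵀ d))    (suc i) =
    trans (ℤFinSupp.at-cons _ (σ t ⊕ nzᵀ d) i)
      (trans (at-⊕ (σ t) (nzᵀ d) i) (cong (ℤ._+ atᵀ (nzᵀ d) i) (ℤFinSupp.at-tail t i)))

  at-⊖ : ∀ d i → atᵀ (⊖ d) i ≡ ℤ.- atᵀ d i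
  at-⊖ 0ᵀ                i       = refl
  at-⊖ (nzᵀ (lastᵀ b _)) zero    = ℤFinSupp.head-cons _ 0ᵀ
  at-⊖ (nzᵀ (lastᵀ b _)) (suc i) = ℤFinSupp.at-cons (ℤ.- b) 0ᵀ i
  at-⊖ (nzᵀ (b ∷ᵀ d))    zero    = ℤFinSupp.head-cons _ (⊖ nzᵀ d)
  at-⊖ (nzᵀ (b ∷ᵀ d))    (suc i) = trans (ℤFinSupp.at-cons _ (⊖ nzᵀ d) i) (at-⊖ (nzᵀ d) i)

σ-⊕ : ∀ t d → σ (t ⊕ d) ≡ σ t ⊕ σ d
σ-⊕ t d = ℤFinSupp.ext _ _ λ i → trans (ℤFinSupp.at-tail (t ⊕ d) i) (trans (at-⊕ t d (suc i))
  (sym (trans (at-⊕ (σ t) (σ d) i) (cong₂ ℤ._+_ (ℤFinSupp.at-tail t i) (ℤFinSupp.at-tail d i)))))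

σ-⊖ : ∀ d → σ (⊖ d) ≡ ⊖ σ d
σ-⊖ d = ℤFinSupp.ext _ _ λ i → trans (ℤFinSupp.at-tail (⊖ d) i) (trans (at-⊖ d (suc i))
  (sym (trans (at-⊖ (σ d) i) (cong ℤ.-_ (ℤFinSupp.at-tail d i)))))

⊕-⊖ : ∀ t d → t ⊕ d ⊕ (⊖ d) ≡ t
⊕-⊖ t d = ℤFinSupp.ext _ _ λ i → trans (at-⊕ (t ⊕ d) (⊖ d) i)
  (trans (cong₂ ℤ._+_ (at-⊕ t d i) (at-⊖ d i))
    (trans (ℤ.+-assoc (atᵀ t i) (atᵀ d i) _)
      (trans (cong (ℤ._+_ (atᵀ t i)) (ℤ.+-inverseʳ (atᵀ d i))) (ℤ.+-identityʳ _))))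

⊖-⊕ : ∀ t d → t ⊕ (⊖ d) ⊕ d ≡ t
⊖-⊕ t d = ℤFinSupp.ext _ _ λ i → trans (at-⊕ (t ⊕ (⊖ d)) d i)
  (trans (cong (ℤ._+ atᵀ d i) (trans (at-⊕ t (⊖ d) i) (cong (ℤ._+_ (atᵀ t i)) (at-⊖ d i))))
    (trans (ℤ.+-assoc (atᵀ t i) _ (atᵀ d i))
      (trans (cong (ℤ._+_ (atᵀ t i)) (ℤ.+-inverseˡ (atᵀ d i))) (ℤ.+-identityʳ _))))

⊕-comm : ∀ t d → t ⊕ d ≡ d ⊕ t
⊕-comm t d = ℤFinSupp.ext _ _ λ i →
  trans (at-⊕ t d i) (trans (ℤ.+-comm (atᵀ t i) (atᵀ d i)) (sym (at-⊕ d t i)))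

S-⊕ : ∀ t d → S t ⊕ d ≡ S (t ⊕ d)
S-⊕ t d = T-ext
  (trans (at-⊕ (S t) d 0) (trans (cong (ℤ._+ k d) (k-bump 1ℤ t))
    (trans (ℤ.+-assoc 1ℤ (k t) (k d)) (sym (trans (k-bump 1ℤ (t ⊕ d)) (cong (ℤ._+_ 1ℤ) (at-⊕ t d 0)))))))
  (trans (σ-⊕ (S t) d) (trans (cong (_⊕ σ d) (σ-bump 1ℤ t))
    (sym (trans (σ-bump 1ℤ (t ⊕ d)) (σ-⊕ t d)))))

-- Commuting with `s` lets symmetries act on the coordinates of a tuple, as diagonal edges apply `s`
-- to all coordinates but one.
record Symmetry : Set where
  field
    apply unapply : V → V
    apply-unapply : ∀ x → apply (unapply x) ≡ x
    unapply-apply : ∀ x → unapply (apply x) ≡ x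
    apply-⟶    : ∀ {x y} → x ⟶ y → apply x ⟶ apply y
    unapply-⟶  : ∀ {x y} → x ⟶ y → unapply x ⟶ unapply y
    apply-s    : ∀ x → apply (s x) ≡ s (apply x)
    unapply-s  : ∀ x → unapply (s x) ≡ s (unapply x)

open Symmetry

inverse : Symmetry → Symmetry
inverse f = record
  { apply = f .unapply ; unapply = f .apply ; apply-unapply = f .unapply-apply ; unapply-apply = f .apply-unapply
  ; apply-⟶ = f .unapply-⟶ ; unapply-⟶ = f .apply-⟶ ; apply-s = f .unapply-s ; unapply-s = f .apply-s }

identity : Symmetry
identity = record
  { apply = id ; unapply = id ; apply-unapply = λ _ → refl ; unapply-apply = λ _ → refl
  ; apply-⟶ = id ; unapply-⟶ = id ; apply-s = λ _ → refl ; unapply-s = λ _ → refl }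

_∘ˢ_ : Symmetry → Symmetry → Symmetry
f ∘ˢ g = record
  { apply = f .apply ∘ g .apply ; unapply = g .unapply ∘ f .unapply
  ; apply-unapply = λ x → trans (cong (f .apply) (g .apply-unapply _)) (f .apply-unapply x)
  ; unapply-apply = λ x → trans (cong (g .unapply) (f .unapply-apply _)) (g .unapply-apply x)
  ; apply-⟶ = f .apply-⟶ ∘ g .apply-⟶ ; unapply-⟶ = g .unapply-⟶ ∘ f .unapply-⟶
  ; apply-s = λ x → trans (cong (f .apply) (g .apply-s x)) (f .apply-s _)
  ; unapply-s = λ x → trans (cong (g .unapply) (f .unapply-s x)) (g .unapply-s _) }

-- W m is the rotation of a node whose parent has head m; coherence makes it
-- compatible with passing from x to y in Step n x y.
Coherent : (ℤ → T) → Set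
Coherent W = ∀ m → W (1ℤ ℤ.+ m) ≡ σ (W m)

module _ (n : ℕ) (W : ℤ → T) where

  rotate : V → V
  rotate x = x [ n ≔ x ! n ⊕ W (k (x ! suc n)) ]

  rotate-at : ∀ x → rotate x ! n ≡ x ! n ⊕ W (k (x ! suc n))
  rotate-at x = Levels.at-≔ x n _

  rotate-off : ∀ x {l} → l ≢ n → rotate x ! l ≡ x ! l
  rotate-off x = Levels.at-≔′ x n _ _

  -- A deletion at level `n` is matched by coherence, since the head at `suc n` rises by 1; a bump
  -- at level `n` commutes with adding a value of `W`; a step further below leaves both levels
  -- unchanged.
  rotate-Step : Coherent W → ∀ {m x y} → Step m x y → Step m (rotate x) (rotate y)
  rotate-Step coh {m} {x} {y} p = record { low = lo ; mid = mi ; high = agree hi }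
    where
    lo : rotate y ! m ≡ σ (rotate x ! m)
    lo with m ℕ.≟ n
    ... | no m≢n = trans (rotate-off y m≢n) (trans (p .low) (cong σ (sym (rotate-off x m≢n))))
    ... | yes refl = trans (rotate-at y) (trans
      (cong₂ _⊕_ (p .low) (trans (cong (W ∘ k) (p .mid)) (trans (cong W (k-bump 1ℤ _)) (coh _))))
      (sym (trans (cong σ (rotate-at x)) (σ-⊕ _ _))))

    mi : rotate y ! suc m ≡ S (rotate x ! suc m)
    mi with suc m ℕ.≟ n
    ... | no m≢n = trans (rotate-off y m≢n) (trans (p .mid) (cong S (sym (rotate-off x m≢n))))
    ... | yes refl = trans (rotate-at y) (trans
      (cong₂ _⊕_ (p .mid) (cong (W ∘ k) (p .high .on ℕ.≤-refl)))
      (trans (S-⊕ _ _) (cong S (sym (rotate-at x)))))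

    hi : ∀ {l} → suc (suc m) ≤ l → rotate y ! l ≡ rotate x ! l
    hi {l} h with l ℕ.≟ n
    ... | no l≢n = trans (rotate-off y l≢n) (trans (p .high .on h) (sym (rotate-off x l≢n)))
    ... | yes refl = trans (rotate-at y) (trans
      (cong₂ _⊕_ (p .high .on h) (cong (W ∘ k) (p .high .on (ℕ.m≤n⇒m≤1+n h))))
      (sym (rotate-at x)))

  rotate-s : ∀ x → rotate (s x) ≡ s (rotate x)
  rotate-s x = V-≡ at0 (agree λ {l} → above {l})
    where
    at0 : rotate (s x) ! 0 ≡ s (rotate x) ! 0
    at0 with 0 ℕ.≟ n
    ... | no 0≢n = trans (rotate-off (s x) 0≢n) (trans (slide-0 1ℤ x)
      (sym (trans (slide-0 1ℤ (rotate x)) (cong S (rotate-off x 0≢n)))))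
    ... | yes refl = trans (rotate-at (s x)) (trans
      (cong₂ _⊕_ (slide-0 1ℤ x) (cong (W ∘ k) (slide-agree 1ℤ x .on (s≤s z≤n))))
      (trans (S-⊕ _ _) (sym (trans (slide-0 1ℤ (rotate x)) (cong S (rotate-at x))))))

    above : ∀ {l} → 1 ≤ l → rotate (s x) ! l ≡ s (rotate x) ! l
    above {l} h with l ℕ.≟ n
    ... | no l≢n = trans (rotate-off (s x) l≢n) (trans (slide-agree 1ℤ x .on h)
      (sym (trans (slide-agree 1ℤ (rotate x) .on h) (rotate-off x l≢n))))
    ... | yes refl = trans (rotate-at (s x)) (trans
      (cong₂ _⊕_ (slide-agree 1ℤ x .on h) (cong (W ∘ k) (slide-agree 1ℤ x .on (ℕ.m≤n⇒m≤1+n h))))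
      (sym (trans (slide-agree 1ℤ (rotate x) .on h) (rotate-at x))))

-- `rotate` reads level `suc n` but changes level `n` only, so both rotations use the same argument
-- `m`.
rotate-inverse : ∀ n W W′ → (∀ m t → t ⊕ W m ⊕ W′ m ≡ t) → ∀ x → rotate n W′ (rotate n W x) ≡ x
rotate-inverse n W W′ inv x = V-ext _ _ λ l → go l
  where
  go : ∀ l → rotate n W′ (rotate n W x) ! l ≡ x ! l
  go l with l ℕ.≟ n
  ... | no l≢n = trans (rotate-off n W′ (rotate n W x) l≢n) (rotate-off n W x l≢n)
  ... | yes refl = trans (rotate-at n W′ (rotate n W x)) (trans
    (cong₂ (λ t u → t ⊕ W′ (k u)) (rotate-at n W x) (rotate-off n W x (ℕ.>⇒≢ ℕ.≤-refl)))
    (inv _ _))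

rotation : ∀ n W → Coherent W → Symmetry
rotation n W coh = record
  { apply      = rotate n W
  ; unapply    = rotate n (⊖_ ∘ W)
  ; apply-unapply = rotate-inverse n (⊖_ ∘ W) W λ m t → ⊖-⊕ t (W m)
  ; unapply-apply = rotate-inverse n W (⊖_ ∘ W) λ m t → ⊕-⊖ t (W m)
  ; apply-⟶    = λ (m , p) → m , rotate-Step n W coh p
  ; unapply-⟶  = λ (m , p) → m , rotate-Step n (⊖_ ∘ W) coh⁻ p
  ; apply-s    = rotate-s n W
  ; unapply-s  = rotate-s n (⊖_ ∘ W)
  }
  where
  coh⁻ : Coherent (⊖_ ∘ W)
  coh⁻ m = trans (cong ⊖_ (coh m)) (sym (σ-⊖ (W m)))

-- Coherence leaves the new leading entries at negative arguments free; they are 0.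
shift : T → ℤ → T
shift d (+ zero)       = d
shift d (+ suc n)      = σ (shift d (+ n))
shift d -[1+ zero ]    = consᵀ 0ℤ d
shift d -[1+ suc n ]   = consᵀ 0ℤ (shift d -[1+ n ])

shift-coherent : ∀ d → Coherent (shift d)
shift-coherent d (+ n)        = refl
shift-coherent d -[1+ zero ]  = sym (ℤFinSupp.tail-cons 0ℤ d)
shift-coherent d -[1+ suc n ] = sym (ℤFinSupp.tail-cons 0ℤ (shift d -[1+ n ]))

-- One rotation per level, from the top down, corrects `x`; levels already corrected lie above and
-- stay as they are.
transitive : ∀ x y → ∃ λ f → apply f x ≡ y
transitive x y with eventually-agree x y
... | n , e = go n x e
  where
  go : ∀ n x → Agree n x y → ∃ λ f → apply f x ≡ y
  go zero    x e = identity , Agree-0 e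
  go (suc n) x e = let f , p = go n (rotate n W x) e′ in f ∘ˢ rotation n W coh , p
    where
    c = k (x ! suc n)
    d = y ! n ⊕ (⊖ (x ! n))
    -- Translation by `c`, the head that `x` has at level `suc n`, makes `W c` equal to `d`, the
    -- difference to be added at level `n`.
    W : ℤ → T
    W m = shift d (m ℤ.+ (ℤ.- c))
    coh : Coherent W
    coh m = trans (cong (shift d) (ℤ.+-assoc 1ℤ m (ℤ.- c))) (shift-coherent d (m ℤ.+ (ℤ.- c)))
    lev : rotate n W x ! n ≡ y ! n
    lev = trans (rotate-at n W x) (trans (cong (λ i → x ! n ⊕ shift d i) (ℤ.+-inverseʳ c))
      (trans (⊕-comm (x ! n) d) (⊖-⊕ (y ! n) (x ! n))))
    e′ : Agree n (rotate n W x) y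
    e′ = agree λ {l} n≤l → [ (λ n<l → trans (rotate-off n W x (ℕ.>⇒≢ n<l)) (e .on n<l))
                           , (λ { refl → lev }) ]′ (ℕ.m≤n⇒m<n∨m≡n n≤l)

-- A step bumps the topmost level that it changes, and agreement above `m` puts that level at `m` or
-- below.
⟶-top : ∀ {m x y} → Agree (suc m) x y → x ⟶ y → y ! m ≡ S (x ! m) ⊎ y ! m ≡ x ! m
⟶-top {m} e (n , p) with ℕ.<-cmp (suc n) m
... | tri< n<m _ _ = inj₂ (p .high .on n<m)
... | tri≈ _ refl _ = inj₁ (p .mid)
... | tri> _ _ m<n = contradiction (trans (sym (p .mid)) (sym (e .on m<n))) S≢

-- Edges between tuples

record Line {d} (i : Fin d) (u v : Vec V d) : Set where
  constructor mkLine
  field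
    change : lookup u i ≢ lookup v i
    same   : ∀ {j} → j ≢ i → lookup v j ≡ lookup u j

record Diagonal {d} (i : Fin d) (u v : Vec V d) : Set where
  constructor mkDiagonal
  field
    climb : lookup u i ⟶ lookup v i
    slid  : ∀ {j} → j ≢ i → lookup v j ≡ s (lookup u j)

open Line
open Diagonal

data Edge {d} (u v : Vec V d) : Set where
  line : ∀ i → Line i u v → Edge u v
  rise : ∀ i → Diagonal i u v → Edge u v
  fall : ∀ i → Diagonal i v u → Edge u v

Line-sym : ∀ {d} {i : Fin d} {u v} → Line i u v → Line i v u
Line-sym p = mkLine (≢-sym (p .change)) (λ j≢i → sym (p .same j≢i))

Edge-sym : ∀ {d} {u v : Vec V d} → Edge u v → Edge v u
Edge-sym (line i p) = line i (Line-sym p)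
Edge-sym (rise i p) = fall i p
Edge-sym (fall i p) = rise i p

lookup-ext : ∀ {A : Set} {d} (u v : Vec A d) → (∀ i → lookup u i ≡ lookup v i) → u ≡ v
lookup-ext u v e =
  trans (sym (Vec.tabulate∘lookup u)) (trans (Vec.tabulate-cong e) (Vec.tabulate∘lookup v))

other : ∀ {d} (i : Fin (suc (suc d))) → ∃ λ j → j ≢ i
other zero    = suc zero , λ ()
other (suc i) = zero , λ ()

⟶≢s : ∀ {x y} → x ⟶ y → y ≢ s x
⟶≢s p e = ⟶-disagree p (s-agree e)

⟶≢s⁻ : ∀ {x y} → x ⟶ y → x ≢ s y
⟶≢s⁻ p e = ⟶-disagree p (Agree-sym (s-agree e))

-- Diagonal edges seen above level 0, where slides are invisible: orientation is lost and only
-- coordinate `i` changes.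
record Skew {d} (i : Fin d) (u v : Vec V d) : Set where
  constructor mkSkew
  field
    disagree : ¬ Agree 1 (lookup u i) (lookup v i)
    agrees   : ∀ {j} → j ≢ i → Agree 1 (lookup u j) (lookup v j)

open Skew

rise-Skew : ∀ {d} {i : Fin d} {u v} → Diagonal i u v → Skew i u v
rise-Skew p = mkSkew (⟶-disagree (p .climb)) (λ j≢i → s-agree (p .slid j≢i))

fall-Skew : ∀ {d} {i : Fin d} {u v} → Diagonal i v u → Skew i u v
fall-Skew p = mkSkew (⟶-disagree (p .climb) ∘ Agree-sym) (λ j≢i → Agree-sym (s-agree (p .slid j≢i)))

-- Above level 0 each side of the triangle changes one coordinate, and no coordinate can be changed
-- by exactly one side of a closed triangle.
Skew-compose : ∀ {d} {i l m : Fin d} {u w v} →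
  Skew i u v → Skew l u w → Skew m w v → l ≡ i × m ≡ i
Skew-compose {i = i} {l} {m} p q r with l Fin.≟ i
... | yes refl with m Fin.≟ i
...   | yes refl = refl , refl
...   | no  m≢i  =
  contradiction (Agree-trans (Agree-sym (q .agrees m≢i)) (p .agrees m≢i)) (r .disagree)
Skew-compose {i = i} {l} {m} p q r | no l≢i with m Fin.≟ l
...   | yes refl =
  contradiction (Agree-trans (q .agrees (≢-sym l≢i)) (r .agrees (≢-sym l≢i))) (p .disagree)
...   | no m≢l   =
  contradiction (Agree-trans (p .agrees l≢i) (Agree-sym (r .agrees (≢-sym m≢l)))) (q .disagree)

Off : ∀ {d} → Fin d → Vec V d → Vec V d → Set
Off i u w = ∀ {j} → j ≢ i → lookup w j ≡ lookup u j

module _ {d} {i : Fin (suc (suc d))} {u v w : Vec V (suc (suc d))} (p : Diagonal i u v) where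

  private
    -- The first edge leaves coordinate `i` alone, so the second must make the whole step there: a
    -- slide moves only level 0, a fall would reverse the step, and a rise would also force `w` and
    -- `u` to agree in coordinate `l`. Only a line in direction `i` remains.
    line-edge : ∀ {l} → l ≢ i → Line l u w → Edge w v → Off i u w ⊎ Off i v w
    line-edge {l} l≢i q (line m r) with m Fin.≟ i
    ... | yes refl = inj₂ λ j≢i → sym (r .same j≢i)
    ... | no m≢i   = contradiction
      (subst (lookup u i ⟶_) (trans (r .same (≢-sym m≢i)) (q .same (≢-sym l≢i))) (p .climb)) ⟶-irrefl
    line-edge l≢i q (rise m r) with m Fin.≟ i
    ... | yes refl = contradiction (s-injective (trans (sym (p .slid l≢i)) (r .slid l≢i))) (q .change)
    ... | no m≢i   = contradiction
      (trans (r .slid (≢-sym m≢i)) (cong s (q .same (≢-sym l≢i)))) (⟶≢s (p .climb))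
    line-edge l≢i q (fall m r) with m Fin.≟ i
    ... | yes refl = contradiction
      (subst (lookup v i ⟶_) (q .same (≢-sym l≢i)) (r .climb)) (⟶-asym (p .climb))
    ... | no m≢i   = contradiction
      (trans (sym (q .same (≢-sym l≢i))) (r .slid (≢-sym m≢i))) (⟶≢s⁻ (p .climb))

    edge-line : ∀ {m} → m ≢ i → Edge u w → Line m w v → Off i u w ⊎ Off i v w
    edge-line m≢i (line l q) r with l Fin.≟ i
    ... | yes refl = inj₁ (q .same)
    ... | no l≢i   = line-edge l≢i q (line _ r)
    edge-line m≢i (rise l q) r with l Fin.≟ i
    ... | yes refl = contradiction (trans (q .slid m≢i) (sym (p .slid m≢i))) (r .change)
    ... | no l≢i   = contradiction
      (trans (r .same (≢-sym m≢i)) (q .slid (≢-sym l≢i))) (⟶≢s (p .climb))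
    edge-line m≢i (fall l q) r with l Fin.≟ i
    ... | yes refl = contradiction
      (subst (_⟶ lookup u i) (sym (r .same (≢-sym m≢i))) (q .climb)) (⟶-asym (p .climb))
    ... | no l≢i   = contradiction
      (trans (q .slid (≢-sym l≢i)) (cong s (sym (r .same (≢-sym m≢i))))) (⟶≢s⁻ (p .climb))

    j = proj₁ (other i)
    j≢i = proj₂ (other i)

  -- Three diagonal edges would have the same direction by `Skew-compose`; in another coordinate
  -- `j`, which exists in dimension at least 2, three slides by 1 or -1 around the triangle cannot
  -- cancel.
  common-neighbour : Edge u w → Edge w v → Off i u w ⊎ Off i v w
  common-neighbour (line l q) e with l Fin.≟ i
  ... | yes refl = inj₁ (q .same)
  ... | no l≢i   = line-edge l≢i q e
  common-neighbour e@(rise _ _) (line m r) with m Fin.≟ i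
  ... | yes refl = inj₂ λ j≢i → sym (r .same j≢i)
  ... | no m≢i   = edge-line m≢i e r
  common-neighbour e@(fall _ _) (line m r) with m Fin.≟ i
  ... | yes refl = inj₂ λ j≢i → sym (r .same j≢i)
  ... | no m≢i   = edge-line m≢i e r
  common-neighbour (rise l q) (rise m r)
    with refl , refl ← Skew-compose (rise-Skew p) (rise-Skew q) (rise-Skew r) =
    contradiction (s-injective (trans (sym (trans (r .slid j≢i) (cong s (q .slid j≢i)))) (p .slid j≢i))) s≢
  common-neighbour (rise l q) (fall m r)
    with refl , refl ← Skew-compose (rise-Skew p) (rise-Skew q) (fall-Skew r) =
    contradiction (trans (sym (p .slid j≢i)) (s-injective (trans (sym (r .slid j≢i)) (q .slid j≢i)))) s≢
  common-neighbour (fall l q) (rise m r)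
    with refl , refl ← Skew-compose (rise-Skew p) (fall-Skew q) (rise-Skew r) =
    contradiction (trans (sym (p .slid j≢i)) (trans (r .slid j≢i) (sym (q .slid j≢i)))) s≢
  common-neighbour (fall l q) (fall m r)
    with refl , refl ← Skew-compose (rise-Skew p) (fall-Skew q) (fall-Skew r) =
    contradiction
      (sym (trans (p .slid j≢i) (cong s (trans (q .slid j≢i) (cong s (r .slid j≢i)))))) sss≢

-- Recognising line edges

Apart : ∀ {d} → Vec V d → Vec V d → Set
Apart u v = u ≢ v × ¬ Edge u v

-- A line edge has three pairwise nonadjacent common neighbours (far along the line,
-- and above and below it), a diagonal edge has not, since its common neighbours lie
-- on two lines.
record Wide {d} (u v : Vec V d) : Set where
  field
    {a b c} : Vec V d
    ua : Edge u a
    ub : Edge u b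
    uc : Edge u c
    av : Edge a v
    bv : Edge b v
    cv : Edge c v
    ab : Apart a b
    bc : Apart b c
    ca : Apart c a

open Wide

Off-¬Apart : ∀ {d} (i : Fin d) u {v w} → Off i u v → Off i u w → ¬ Apart v w
Off-¬Apart i u {v} {w} p q (v≢w , ¬e) = ¬e (line i (mkLine change′ λ j≢i → trans (q j≢i) (sym (p j≢i))))
  where
  change′ : lookup v i ≢ lookup w i
  change′ e = v≢w (lookup-ext v w λ j → case j)
    where
    case : ∀ j → lookup v j ≡ lookup w j
    case j with j Fin.≟ i
    ... | yes refl = e
    ... | no j≢i   = trans (p j≢i) (sym (q j≢i))

-- By pigeonhole two of the three neighbours share a line in direction `i`, hence are equal or
-- adjacent.
Diagonal-¬Wide : ∀ {d} {i : Fin (suc (suc d))} {u v} → Diagonal i u v → ¬ Wide u v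
Diagonal-¬Wide {i = i} {u} {v} p w
  with common-neighbour p (w .ua) (w .av) | common-neighbour p (w .ub) (w .bv) | common-neighbour p (w .uc) (w .cv)
... | inj₁ x | inj₁ y | _      = Off-¬Apart i u x y (w .ab)
... | inj₂ x | inj₂ y | _      = Off-¬Apart i v x y (w .ab)
... | _      | inj₁ x | inj₁ y = Off-¬Apart i u x y (w .bc)
... | _      | inj₂ x | inj₂ y = Off-¬Apart i v x y (w .bc)
... | inj₁ x | _      | inj₁ y = Off-¬Apart i u y x (w .ca)
... | inj₂ x | _      | inj₂ y = Off-¬Apart i v y x (w .ca)

Wide-sym : ∀ {d} {u v : Vec V d} → Wide u v → Wide v u
Wide-sym w = record
  { ua = Edge-sym (w .av) ; ub = Edge-sym (w .bv) ; uc = Edge-sym (w .cv)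
  ; av = Edge-sym (w .ua) ; bv = Edge-sym (w .ub) ; cv = Edge-sym (w .uc)
  ; ab = w .ab ; bc = w .bc ; ca = w .ca }

Wide⇒Line : ∀ {d} {u v : Vec V (suc (suc d))} → Wide u v → Edge u v → ∃ λ i → Line i u v
Wide⇒Line w (line i p) = i , p
Wide⇒Line w (rise i p) = contradiction w (Diagonal-¬Wide p)
Wide⇒Line w (fall i p) = contradiction (Wide-sym w) (Diagonal-¬Wide p)

module _ {d} (i : Fin (suc (suc d))) (u : Vec V (suc (suc d))) where

  -- The integer `m` records how far the other coordinates have slid; a diagonal edge between two
  -- such vertices raises it by 1 and is a step in coordinate `i`.
  spread : ℤ → V → Vec V (suc (suc d))
  spread m x = Data.Vec.map (slide m) u [ i ]≔ x

  spread-at : ∀ m x → lookup (spread m x) i ≡ x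
  spread-at m x = Vec.lookup∘update i (Data.Vec.map (slide m) u) x

  spread-off : ∀ m x {j} → j ≢ i → lookup (spread m x) j ≡ slide m (lookup u j)
  spread-off m x {j} j≢i = trans (Vec.lookup∘update′ j≢i (Data.Vec.map (slide m) u) x) (Vec.lookup-map j (slide m) u)

  spread-Diagonal : ∀ m n x y → n ≡ 1ℤ ℤ.+ m → x ⟶ y → Diagonal i (spread m x) (spread n y)
  spread-Diagonal m n x y refl p = mkDiagonal
    (subst₂ _⟶_ (sym (spread-at m x)) (sym (spread-at n y)) p)
    (λ j≢i → trans (spread-off n y j≢i) (sym (trans (cong s (spread-off m x j≢i)) (slide-slide 1ℤ m _))))

  spread-Diagonal⁻¹ : ∀ m n {l} x y → Diagonal l (spread m x) (spread n y) → n ≡ 1ℤ ℤ.+ m × x ⟶ y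
  spread-Diagonal⁻¹ m n {l} x y p with l Fin.≟ i | other i
  ... | yes refl | j , j≢i =
    slide-injective n (1ℤ ℤ.+ m) (lookup u j)
      (trans (sym (spread-off n y j≢i)) (trans (p .slid j≢i) (trans (cong s (spread-off m x j≢i)) (slide-slide 1ℤ m _)))) ,
    subst₂ _⟶_ (spread-at m x) (spread-at n y) (p .climb)
  ... | no l≢i | _ = contradiction
    (Agree-trans (slide-agree m _) (Agree-sym (slide-agree n _)))
    (⟶-disagree (subst₂ _⟶_ (spread-off m x l≢i) (spread-off n y l≢i) (p .climb)))

  spread-¬Line : ∀ m n {l} x y → m ≢ n → x ≢ y → ¬ Line l (spread m x) (spread n y)
  spread-¬Line m n {l} x y m≢n x≢y p with l Fin.≟ i | other i
  ... | no l≢i | _ =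
    x≢y (trans (sym (spread-at m x)) (trans (sym (p .same (≢-sym l≢i))) (spread-at n y)))
  ... | yes refl | j , j≢i =
    m≢n (slide-injective m n (lookup u j) (trans (sym (spread-off m x j≢i)) (trans (sym (p .same j≢i)) (spread-off n y j≢i))))

  spread-Apart : ∀ m n x y → m ≢ n → x ≢ y →
    (n ≡ 1ℤ ℤ.+ m → ¬ x ⟶ y) → (m ≡ 1ℤ ℤ.+ n → ¬ y ⟶ x) →
    Apart (spread m x) (spread n y)
  spread-Apart m n x y m≢n x≢y up′ down′ =
    (λ e → x≢y (trans (sym (spread-at m x)) (trans (cong (λ w → lookup w i) e) (spread-at n y)))) , no-edge
    where
    no-edge : ¬ Edge (spread m x) (spread n y)
    no-edge (rise l p) with e , q ← spread-Diagonal⁻¹ m n x y p = up′ e q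
    no-edge (fall l p) with e , q ← spread-Diagonal⁻¹ n m y x p = down′ e q
    no-edge (line l p) = spread-¬Line m n x y m≢n x≢y p

  unspread : ∀ v → Off i u v → v ≡ spread 0ℤ (lookup v i)
  unspread v p = lookup-ext v _ case
    where
    case : ∀ j → lookup v j ≡ lookup (spread 0ℤ (lookup v i)) j
    case j with j Fin.≟ i
    ... | yes refl = sym (spread-at 0ℤ _)
    ... | no j≢i   = trans (p j≢i) (sym (trans (spread-off 0ℤ _ j≢i) (slide-zero _)))

  spread-Line : ∀ x y → x ≢ y → Line i (spread 0ℤ x) (spread 0ℤ y)
  spread-Line x y x≢y = mkLine
    (λ e → x≢y (trans (sym (spread-at 0ℤ x)) (trans e (spread-at 0ℤ y))))
    (λ j≢i → trans (spread-off 0ℤ y j≢i) (sym (spread-off 0ℤ x j≢i)))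

  spread-Wide : ∀ a c → Wide (spread 0ℤ a) (spread 0ℤ c)
  spread-Wide a c = record
    { ua = line i (spread-Line a far (λ e → SS≢ (sym (trans (cong (_! m) e) far-m))))
    ; av = line i (spread-Line far c (λ e → SS≢ (trans (sym far-m) (trans (cong (_! m) e) (sym (n≈ .on n≤m))))))
    ; ub = rise i (spread-Diagonal 0ℤ 1ℤ a hi refl (n , up-Step n a))
    ; bv = fall i (spread-Diagonal 0ℤ 1ℤ c hi refl (n , Step-respˡ n≈ (up-Step n a)))
    ; uc = fall i (spread-Diagonal -1ℤ 0ℤ lo a refl (n , down-Step n a))
    ; cv = rise i (spread-Diagonal -1ℤ 0ℤ lo c refl (n , Step-respʳ n≈ (down-Step n a)))
    ; ab = spread-Apart 0ℤ 1ℤ far hi (λ ()) far≢hi (λ _ → ¬far⟶hi) λ ()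
    ; bc = spread-Apart 1ℤ -1ℤ hi lo (λ ()) hi≢lo (λ ()) λ ()
    ; ca = spread-Apart -1ℤ 0ℤ lo far (λ ()) lo≢far (λ _ → ¬lo⟶far) λ ()
    }
    where
    -- From level `n` on `a` and `c` agree, so they share the parent `hi` and the child `lo` at that
    -- level.
    n = proj₁ (eventually-agree a c)
    n≈ = proj₂ (eventually-agree a c)
    m = suc (suc n)
    hi = up n a
    lo = down n a
    -- Steps at level `n` leave level `m` alone, and two bumps at `m` are more than one step can
    -- make or undo.
    far = a [ m ≔ S (S (a ! m)) ]

    n≤m : n ≤ m
    n≤m = ℕ.m≤n+m n 2

    far-m : far ! m ≡ S (S (a ! m))
    far-m = Levels.at-≔ a m _

    hi-m : hi ! m ≡ a ! m
    hi-m = up-Step n a .high .on ℕ.≤-refl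

    lo-m : lo ! m ≡ a ! m
    lo-m = sym (down-Step n a .high .on ℕ.≤-refl)

    far≢hi : far ≢ hi
    far≢hi e = SS≢ (trans (sym far-m) (trans (cong (_! m) e) hi-m))

    lo≢far : lo ≢ far
    lo≢far e = SS≢ (trans (sym far-m) (trans (cong (_! m) (sym e)) lo-m))

    hi≢lo : hi ≢ lo
    hi≢lo e = ⟶-asym (n , up-Step n a) (n , subst (λ x → Step n x a) (sym e) (down-Step n a))

    ¬far⟶hi : ¬ far ⟶ hi
    ¬far⟶hi p with ⟶-top (Agree-trans (Agree-≔ a m _) (Agree-mono (ℕ.n≤1+n m) (Agree-sym (up-Step n a .high)))) p
    ... | inj₁ e = SSS≢ (sym (trans (sym hi-m) (trans e (cong S far-m))))
    ... | inj₂ e = SS≢ (trans (sym far-m) (trans (sym e) hi-m))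

    ¬lo⟶far : ¬ lo ⟶ far
    ¬lo⟶far p with ⟶-top (Agree-trans (Agree-mono (ℕ.n≤1+n m) (Agree-sym (down-Step n a .high))) (Agree-sym (Agree-≔ a m _))) p
    ... | inj₁ e = S≢ (trans (sym far-m) (trans e (cong S lo-m)))
    ... | inj₂ e = SS≢ (trans (sym far-m) (trans e lo-m))

abstract
  Line⇒Wide : ∀ {d} {i : Fin (suc (suc d))} {u v} → Line i u v → Wide u v
  Line⇒Wide {i = i} {u} {v} p = subst₂ Wide
    (sym (unspread i u u (λ _ → refl))) (sym (unspread i u v (p .same)))
    (spread-Wide i u (lookup u i) (lookup v i))

-- Coordinates are changed one at a time; `Q` marks those in which `u` and `v` may differ.
update-induction : ∀ {d} (R : Vec V d → Vec V d → Set) (Q : Fin d → Set) →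
  (∀ {u} → R u u) → (∀ {u v w} → R u v → R v w → R u w) →
  (∀ u j a → Q j → R u (u [ j ]≔ a)) →
  ∀ u v → (∀ j → Q j ⊎ lookup u j ≡ lookup v j) → R u v
update-induction R Q R-refl R-trans step [] [] q = R-refl
update-induction R Q R-refl R-trans step (a ∷ u) (b ∷ v) q =
  R-trans (first (q zero))
    (update-induction (λ x y → R (b ∷ x) (b ∷ y)) (Q ∘ suc) R-refl R-trans
      (λ w j → step (b ∷ w) (suc j)) u v (q ∘ suc))
  where
  first : Q zero ⊎ a ≡ b → R (a ∷ u) (b ∷ u)
  first (inj₁ p)    = step (a ∷ u) zero b p
  first (inj₂ refl) = R-refl

-- Automorphisms permute the coordinates

record Auto (d : ℕ) : Set where
  field
    ⟦_⟧ ⟦_⟧⁻ : Vec V d → Vec V d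
    ⟦⟧-⟦⟧⁻   : ∀ u → ⟦_⟧ (⟦_⟧⁻ u) ≡ u
    ⟦⟧⁻-⟦⟧   : ∀ u → ⟦_⟧⁻ (⟦_⟧ u) ≡ u
    edge     : ∀ {u v} → Edge u v → Edge (⟦_⟧ u) (⟦_⟧ v)
    edge⁻    : ∀ {u v} → Edge u v → Edge (⟦_⟧⁻ u) (⟦_⟧⁻ v)

  injective : ∀ {u v} → ⟦_⟧ u ≡ ⟦_⟧ v → u ≡ v
  injective e = trans (sym (⟦⟧⁻-⟦⟧ _)) (trans (cong ⟦_⟧⁻ e) (⟦⟧⁻-⟦⟧ _))

  edge⁻¹ : ∀ {u v} → Edge (⟦_⟧ u) (⟦_⟧ v) → Edge u v
  edge⁻¹ e = subst₂ Edge (⟦⟧⁻-⟦⟧ _) (⟦⟧⁻-⟦⟧ _) (edge⁻ e)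

  apart : ∀ {u v} → Apart u v → Apart (⟦_⟧ u) (⟦_⟧ v)
  apart (u≢v , ¬e) = u≢v ∘ injective , ¬e ∘ edge⁻¹

  wide : ∀ {u v} → Wide u v → Wide (⟦_⟧ u) (⟦_⟧ v)
  wide w = record
    { ua = edge (w .ua) ; ub = edge (w .ub) ; uc = edge (w .uc)
    ; av = edge (w .av) ; bv = edge (w .bv) ; cv = edge (w .cv)
    ; ab = apart (w .ab) ; bc = apart (w .bc) ; ca = apart (w .ca) }

reverse : ∀ {d} → Auto d → Auto d
reverse f = record
  { ⟦_⟧ = ⟦_⟧⁻ ; ⟦_⟧⁻ = ⟦_⟧ ; ⟦⟧-⟦⟧⁻ = ⟦⟧⁻-⟦⟧ ; ⟦⟧⁻-⟦⟧ = ⟦⟧-⟦⟧⁻ ; edge = edge⁻ ; edge⁻ = edge }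
  where open Auto f

Line-unique : ∀ {d} {i j : Fin d} {u v} → Line i u v → Line j u v → i ≡ j
Line-unique {i = i} {j} p q with i Fin.≟ j
... | yes e  = e
... | no i≢j = contradiction (sym (q .same i≢j)) (p .change)

Line-third : ∀ {d} {i : Fin d} {u v w} → Line i u v → Line i u w → v ≢ w → Line i v w
Line-third {i = i} {u} {v} {w} p q v≢w = mkLine change′ (λ j≢i → trans (q .same j≢i) (sym (p .same j≢i)))
  where
  change′ : lookup v i ≢ lookup w i
  change′ e = v≢w (lookup-ext v w case)
    where
    case : ∀ j → lookup v j ≡ lookup w j
    case j with j Fin.≟ i
    ... | yes refl = e
    ... | no j≢i   = trans (p .same j≢i) (sym (q .same j≢i))

Line-update : ∀ {d} (i : Fin d) u {a} → a ≢ lookup u i → Line i u (u [ i ]≔ a)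
Line-update i u a≢ = mkLine (λ e → a≢ (sym (trans e (Vec.lookup∘update i u _))))
  (λ j≢i → Vec.lookup∘update′ j≢i u _)

module Directions {d : ℕ} (f : Auto (suc (suc d))) where
  open Auto f

  abstract
    line-image : ∀ {i u v} → Line i u v → ∃ λ l → Line l (⟦ u ⟧) (⟦ v ⟧)
    line-image {i} p = Wide⇒Line (wide (Line⇒Wide p)) (edge (line i p))

    line-preimage : ∀ {l u v} → Line l (⟦ u ⟧) (⟦ v ⟧) → ∃ λ i → Line i u v
    line-preimage {l} p = Wide⇒Line
      (subst₂ Wide (⟦⟧⁻-⟦⟧ _) (⟦⟧⁻-⟦⟧ _) (Auto.wide (reverse f) (Line⇒Wide p)))
      (edge⁻¹ (line l p))

  -- Different directions would make the images of `v` and `w` differ in two coordinates, although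
  -- `v` and `w` lie on one line.
  same-line : ∀ {i l m u v w} → Line i u v → Line i u w →
    Line l (⟦ u ⟧) (⟦ v ⟧) → Line m (⟦ u ⟧) (⟦ w ⟧) → l ≡ m
  same-line {l = l} {m} {v = v} {w} p q p′ q′ with l Fin.≟ m
  ... | yes e = e
  ... | no l≢m with line-image (Line-third p q λ { refl → l≢m (Line-unique p′ q′) })
  ...   | n , r with n Fin.≟ l
  ...     | no n≢l = contradiction (sym (trans (sym (r .same (≢-sym n≢l))) (q′ .same l≢m))) (p′ .change)
  ...     | yes refl = contradiction
              (sym (trans (r .same (≢-sym l≢m)) (p′ .same (≢-sym l≢m)))) (q′ .change)

  -- If both images lay on one line, the inverse would put `v` and `w` on one line, but they differ
  -- in two coordinates.
  distinct : ∀ {i j l a u v w} → i ≢ j → Line i u v → Line j u w →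
    Line l (⟦ u ⟧) (⟦ v ⟧) → Line a (⟦ u ⟧) (⟦ w ⟧) → l ≢ a
  distinct {i} {j} {u = u} {v} {w} i≢j uv uw uv′ uw′ refl
    with n , vw ← line-preimage (Line-third uv′ uw′ ((λ { refl → uv .change (sym (uw .same i≢j)) }) ∘ injective)) | n Fin.≟ i
  ... | no n≢i   = uv .change (sym (trans (sym (vw .same (≢-sym n≢i))) (uw .same i≢j)))
  ... | yes refl = uw .change (sym (trans (vw .same (≢-sym i≢j)) (uv .same (≢-sym i≢j))))

  -- The image of the square `u`, `v`, `t`, `w` closes up. If `l` and `m` differed, side `vt` would
  -- undo side `uv` and side `wt` would undo side `uw`, so the opposite corners `t` and `u` would
  -- have equal images.
  parallel : ∀ {i j l m u v w t} → i ≢ j → Line i u v → Line j u w → Line j v t → Line i w t →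
    Line l (⟦ u ⟧) (⟦ v ⟧) → Line m (⟦ w ⟧) (⟦ t ⟧) → l ≡ m
  parallel {i} {j} {l} {m} {u} {v} {w} {t} i≢j uv uw vt wt uv′ wt′
    with line-image uw | line-image vt | l Fin.≟ m
  ... | _ | _ | yes e = e
  ... | a , uw′ | b , vt′ | no l≢m = contradiction (injective t≡u) t≢u
    where
    a≢l : l ≢ a
    a≢l = distinct i≢j uv uw uv′ uw′

    t-l : lookup (⟦ t ⟧) l ≡ lookup (⟦ u ⟧) l
    t-l = trans (wt′ .same l≢m) (uw′ .same a≢l)

    b≡l : b ≡ l
    b≡l with b Fin.≟ l
    ... | yes e  = e
    ... | no b≢l = contradiction (sym (trans (sym (vt′ .same (≢-sym b≢l))) t-l)) (uv′ .change)

    t-a : lookup (⟦ t ⟧) a ≡ lookup (⟦ u ⟧) a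
    t-a = trans (vt′ .same (λ e → a≢l (sym (trans e b≡l)))) (uv′ .same (≢-sym a≢l))

    m≡a : m ≡ a
    m≡a with m Fin.≟ a
    ... | yes e  = e
    ... | no m≢a = contradiction (sym (trans (sym (wt′ .same (≢-sym m≢a))) t-a)) (uw′ .change)

    t≡u : ⟦ t ⟧ ≡ ⟦ u ⟧
    t≡u = lookup-ext _ _ case
      where
      case : ∀ x → lookup (⟦ t ⟧) x ≡ lookup (⟦ u ⟧) x
      case x with x Fin.≟ a
      ... | yes refl = t-a
      ... | no x≢a   = trans (wt′ .same (λ e → x≢a (trans e m≡a))) (uw′ .same x≢a)

    t≢u : t ≢ u
    t≢u refl = uv .change (vt .same i≢j)

  nudge : ∀ (i : Fin (suc (suc d))) u → Line i u (u [ i ]≔ s (lookup u i))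
  nudge i u = Line-update i u s≢

  direction : Vec V (suc (suc d)) → Fin (suc (suc d)) → Fin (suc (suc d))
  direction u i = proj₁ (line-image (nudge i u))

  direction-update : ∀ i u j a → direction u i ≡ direction (u [ j ]≔ a) i
  direction-update i u j a with direction u i Fin.≟ direction (u [ j ]≔ a) i
  ... | yes e = e
  ... | no ne = moved
    where
    w = u [ j ]≔ a

    uw : Line j u w
    -- A trivial update would not change the direction, contrary to `ne`, so the update is a line
    -- edge.
    uw = Line-update j u λ { refl → ne (cong (λ v → direction v i) (sym (Vec.[]≔-lookup u j))) }

    moved : direction u i ≡ direction w i
    moved with j Fin.≟ i
    ... | yes refl = trans (same-line (nudge i u) uw (proj₂ (line-image (nudge i u))) (proj₂ (line-image uw)))
                           (same-line (Line-sym uw) (nudge i w) (Line-sym (proj₂ (line-image uw)))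
                                      (proj₂ (line-image (nudge i w))))
    ... | no j≢i = parallel (≢-sym j≢i) (nudge i u) uw vt (nudge i w)
                     (proj₂ (line-image (nudge i u))) (proj₂ (line-image (nudge i w)))
      where
      e : w [ i ]≔ s (lookup w i) ≡ u [ i ]≔ s (lookup u i) [ j ]≔ a
      e = trans (cong (λ x → w [ i ]≔ s x) (Vec.lookup∘update′ (≢-sym j≢i) u a)) (Vec.[]≔-commutes u j i j≢i)

      vt : Line j (u [ i ]≔ s (lookup u i)) (w [ i ]≔ s (lookup w i))
      vt = subst (Line j _) (sym e) (Line-update j _ λ a≡ → uw .change
        (trans (sym (trans a≡ (Vec.lookup∘update′ j≢i u _))) (sym (Vec.lookup∘update j u a))))

  -- Read off at one vertex; by `direction≡τ` every vertex gives the same map.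
  τ : Fin (suc (suc d)) → Fin (suc (suc d))
  τ = direction (replicate _ 0ⱽ)

  direction≡τ : ∀ u i → τ i ≡ direction u i
  direction≡τ u i = update-induction (λ u v → direction u i ≡ direction v i) (λ j → j ≡ j)
    refl trans (λ u j a _ → direction-update i u j a) _ u (λ _ → inj₁ refl)

  axis : ∀ {i u v} → Line i u v → Line (τ i) (⟦ u ⟧) (⟦ v ⟧)
  axis {i} {u} p with l , q ← line-image p =
    subst (λ l → Line l _ _)
      (trans (same-line p (nudge i u) q (proj₂ (line-image (nudge i u)))) (sym (direction≡τ u i))) q

  τ-injective : ∀ {i j} → i ≢ j → τ i ≢ τ j
  τ-injective {i} {j} i≢j = distinct i≢j (nudge i u) (nudge j u) (axis (nudge i u)) (axis (nudge j u))
    where u = replicate _ 0ⱽ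

  -- Coordinates other than `i` can be changed one at a time, each change moving the image in a
  -- direction other than `τ i`.
  component : ∀ i u v → lookup u i ≡ lookup v i → lookup (⟦ u ⟧) (τ i) ≡ lookup (⟦ v ⟧) (τ i)
  component i u v e = update-induction (λ u v → lookup (⟦ u ⟧) (τ i) ≡ lookup (⟦ v ⟧) (τ i))
    (i ≢_) refl trans step u v cases
    where
    step : ∀ u j a → i ≢ j → lookup (⟦ u ⟧) (τ i) ≡ lookup (⟦ u [ j ]≔ a ⟧) (τ i)
    step u j a i≢j with a ≟ⱽ lookup u j
    ... | yes refl = cong (λ w → lookup (⟦ w ⟧) (τ i)) (sym (Vec.[]≔-lookup u j))
    ... | no a≢    = sym (axis (Line-update j u a≢) .same (τ-injective i≢j))

    cases : ∀ j → i ≢ j ⊎ lookup u j ≡ lookup v j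
    cases j with i Fin.≟ j
    ... | yes refl = inj₂ e
    ... | no i≢j   = inj₁ i≢j

-- The action on single coordinates

module Coordinates {d : ℕ} (f : Auto (suc (suc d))) where
  open Auto f
  open Directions f public
  open Directions (reverse f) public using () renaming (τ to τ⁻; axis to axis⁻)

  τ-τ⁻ : ∀ l → τ (τ⁻ l) ≡ l
  τ-τ⁻ l = Line-unique (axis (axis⁻ p)) (subst₂ (Line l) (sym (⟦⟧-⟦⟧⁻ _)) (sym (⟦⟧-⟦⟧⁻ _)) p)
    where p = nudge l (replicate _ 0ⱽ)

  base : Vec V (suc (suc d))
  base = replicate _ 0ⱽ

  map-at : Fin (suc (suc d)) → V → V
  map-at i x = lookup (⟦ base [ i ]≔ x ⟧) (τ i)

  component≡ : ∀ i u → lookup (⟦ u ⟧) (τ i) ≡ map-at i (lookup u i)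
  component≡ i u = component i u _ (sym (Vec.lookup∘update i base _))

  map-at⁻ : Fin (suc (suc d)) → V → V
  map-at⁻ i y = lookup (⟦ base [ τ i ]≔ y ⟧⁻) i

  map-at-map-at⁻ : ∀ i y → map-at i (map-at⁻ i y) ≡ y
  map-at-map-at⁻ i y = trans (sym (component≡ i _))
    (trans (cong (λ w → lookup w (τ i)) (⟦⟧-⟦⟧⁻ _)) (Vec.lookup∘update (τ i) base y))

  private
    no-line : ∀ {i l u v} → Diagonal i u v → ¬ Line l (⟦ u ⟧) (⟦ v ⟧)
    no-line p q with n , r ← line-preimage q = Diagonal-¬Wide p (Line⇒Wide r)

    second-parent : ∀ {x y} → x ⟶ y → ∃ λ z → x ⟶ z × z ≢ y
    second-parent {x} (n , p) = up (suc n) x , (suc n , up-Step (suc n) x) ,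
      λ { refl → Step-unique p (up-Step (suc n) x) ℕ.≤-refl }

  -- The end v of the edge has a second position w on its line; the images of v and
  -- w differ in coordinate τ i only, which rules out diagonals in other directions.
  diagonal-image : ∀ {i u v} → Diagonal i u v →
    Diagonal (τ i) (⟦ u ⟧) (⟦ v ⟧) ⊎ Diagonal (τ i) (⟦ v ⟧) (⟦ u ⟧)
  diagonal-image {i} {u} {v} p with second-parent (p .climb)
  ... | z , u⟶z , z≢v = cases (edge (rise i p))
    where
    w = v [ i ]≔ z

    vw : Line (τ i) (⟦ v ⟧) (⟦ w ⟧)
    vw = axis (Line-update i v z≢v)

    q : Diagonal i u w
    q = mkDiagonal (subst (lookup u i ⟶_) (sym (Vec.lookup∘update i v z)) u⟶z)
                   (λ j≢i → trans (Vec.lookup∘update′ j≢i v z) (p .slid j≢i))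

    -- The images of `v` and `w` coincide in coordinate `l`, so the edge to the image of `w` must
    -- repeat the step there; both edges then slide coordinate `τ i` alike, against `vw`.
    rising : ∀ {l} → l ≢ τ i → Diagonal l (⟦ u ⟧) (⟦ v ⟧) → Edge (⟦ u ⟧) (⟦ w ⟧) → ⊥
    rising l≢τ r (line m t) = no-line q t
    rising {l} l≢τ r (rise m t) with m Fin.≟ l
    ... | yes refl = vw .change (trans (r .slid (≢-sym l≢τ)) (sym (t .slid (≢-sym l≢τ))))
    ... | no m≢l   = ⟶≢s (r .climb) (trans (sym (vw .same l≢τ)) (t .slid (≢-sym m≢l)))
    rising {l} l≢τ r (fall m t) with m Fin.≟ l
    ... | yes refl = ⟶-asym (r .climb) (subst (_⟶ lookup (⟦ u ⟧) l) (vw .same l≢τ) (t .climb))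
    ... | no m≢l   = ⟶≢s⁻ (r .climb) (trans (t .slid (≢-sym m≢l)) (cong s (vw .same l≢τ)))

    falling : ∀ {l} → l ≢ τ i → Diagonal l (⟦ v ⟧) (⟦ u ⟧) → Edge (⟦ u ⟧) (⟦ w ⟧) → ⊥
    falling l≢τ r (line m t) = no-line q t
    falling {l} l≢τ r (fall m t) with m Fin.≟ l
    ... | yes refl = vw .change (s-injective (trans (sym (r .slid (≢-sym l≢τ))) (t .slid (≢-sym l≢τ))))
    ... | no m≢l   = ⟶≢s (r .climb) (trans (t .slid (≢-sym m≢l)) (cong s (vw .same l≢τ)))
    falling {l} l≢τ r (rise m t) with m Fin.≟ l
    ... | yes refl = ⟶-asym (r .climb) (subst (lookup (⟦ u ⟧) l ⟶_) (vw .same l≢τ) (t .climb))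
    ... | no m≢l   = ⟶≢s⁻ (r .climb) (trans (sym (vw .same l≢τ)) (t .slid (≢-sym m≢l)))

    cases : Edge (⟦ u ⟧) (⟦ v ⟧) → Diagonal (τ i) (⟦ u ⟧) (⟦ v ⟧) ⊎ Diagonal (τ i) (⟦ v ⟧) (⟦ u ⟧)
    cases (line l r) = contradiction r (no-line p)
    cases (rise l r) with l Fin.≟ τ i
    ... | yes refl = inj₁ r
    ... | no l≢τ   = ⊥-elim (rising l≢τ r (edge (rise i q)))
    cases (fall l r) with l Fin.≟ τ i
    ... | yes refl = inj₂ r
    ... | no l≢τ   = ⊥-elim (falling l≢τ r (edge (rise i q)))

  private
    -- In coordinate `j` both edges slide the same point to the same point. Images of opposite sign
    -- would give a point fixed by two slides.
    tail-sign : ∀ {i j u v u′ v′} → j ≢ i → lookup u j ≡ lookup u′ j →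
      Diagonal i u v → Diagonal i u′ v′ →
      Diagonal (τ i) (⟦ u ⟧) (⟦ v ⟧) → ¬ Diagonal (τ i) (⟦ v′ ⟧) (⟦ u′ ⟧)
    tail-sign {i} {j} {u} {v} {u′} {v′} j≢i e p p′ q q′ = ss≢ (sym (trans
      (trans (component j u u′ e) (q′ .slid (τ-injective j≢i)))
      (cong s (trans (component j v′ v (trans (p′ .slid j≢i) (trans (cong s (sym e)) (sym (p .slid j≢i)))))
                     (q .slid (τ-injective j≢i))))))

    head-sign : ∀ {i u v u′ v′} → lookup u i ≡ lookup u′ i → lookup v i ≡ lookup v′ i →
      Diagonal (τ i) (⟦ u ⟧) (⟦ v ⟧) → ¬ Diagonal (τ i) (⟦ v′ ⟧) (⟦ u′ ⟧)
    head-sign {i} {u} {v} {u′} {v′} e e′ q q′ = ⟶-asym (q .climb)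
      (subst₂ _⟶_ (component i v′ v (sym e′)) (component i u′ u (sym e)) (q′ .climb))

  module _ (i : Fin (suc (suc d))) where

    private
      j = proj₁ (other i)
      j≢i = proj₂ (other i)
      x₀ = up 0 0ⱽ
      o₀ = spread i base 0ℤ 0ⱽ
      o₁ = spread i base 1ℤ x₀

      o : Diagonal i o₀ o₁
      o = spread-Diagonal i base 0ℤ 1ℤ 0ⱽ x₀ refl (0 , up-Step 0 0ⱽ)

      -- This edge shares coordinate `i` with the reference edge `o` and all other coordinates with
      -- the given edge, so it links their signs.
      mix : ∀ {u v} → Diagonal i u v → Diagonal i (u [ i ]≔ 0ⱽ) (v [ i ]≔ x₀)
      mix {u} {v} p = mkDiagonal
        (subst₂ _⟶_ (sym (Vec.lookup∘update i u _)) (sym (Vec.lookup∘update i v _)) (0 , up-Step 0 0ⱽ))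
        (λ l≢i → trans (Vec.lookup∘update′ l≢i v _)
          (trans (p .slid l≢i) (cong s (sym (Vec.lookup∘update′ l≢i u _)))))

    Upright Inverted : Set
    Upright  = ∀ {u v} → Diagonal i u v → Diagonal (τ i) (⟦ u ⟧) (⟦ v ⟧)
    Inverted = ∀ {u v} → Diagonal i u v → Diagonal (τ i) (⟦ v ⟧) (⟦ u ⟧)

    -- The sign of the image of a diagonal edge can be read off coordinate i
    -- alone, and also off any other coordinate alone.
    orientation : Upright ⊎ Inverted
    orientation with diagonal-image o
    ... | inj₁ o↑ = inj₁ upright
      where
      upright : Upright
      upright {u} {v} p with diagonal-image p | diagonal-image (mix p)
      ... | inj₁ q | _       = q
      ... | inj₂ q | inj₁ q′ = ⊥-elim (tail-sign j≢i (Vec.lookup∘update′ j≢i u _) (mix p) p q′ q)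
      ... | inj₂ q | inj₂ q′ = ⊥-elim (head-sign
        (trans (spread-at i base 0ℤ 0ⱽ) (sym (Vec.lookup∘update i u _)))
        (trans (spread-at i base 1ℤ x₀) (sym (Vec.lookup∘update i v _))) o↑ q′)
    ... | inj₂ o↓ = inj₂ inverted
      where
      inverted : Inverted
      inverted {u} {v} p with diagonal-image p | diagonal-image (mix p)
      ... | inj₂ q | _       = q
      ... | inj₁ q | inj₂ q′ = ⊥-elim (tail-sign j≢i (sym (Vec.lookup∘update′ j≢i u _)) p (mix p) q q′)
      ... | inj₁ q | inj₁ q′ = ⊥-elim (head-sign
        (trans (Vec.lookup∘update i u _) (sym (spread-at i base 0ℤ 0ⱽ)))
        (trans (Vec.lookup∘update i v _) (sym (spread-at i base 1ℤ x₀))) q′ o↓)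

    private
      ψ = map-at i

      at-spread : ∀ m x → lookup (⟦ spread i base m x ⟧) (τ i) ≡ ψ x
      at-spread m x = trans (component≡ i _) (cong ψ (spread-at i base m x))

      off-spread : ∀ m x y {l} → l ≢ τ i →
        lookup (⟦ spread i base m x ⟧) l ≡ lookup (⟦ spread i base m y ⟧) l
      off-spread m x y {l} l≢τ = subst
        (λ l → lookup (⟦ spread i base m x ⟧) l ≡ lookup (⟦ spread i base m y ⟧) l) (τ-τ⁻ l)
        (component (τ⁻ l) _ _ (trans (spread-off i base m x τ⁻≢i) (sym (spread-off i base m y τ⁻≢i))))
        where
        τ⁻≢i : τ⁻ l ≢ i
        τ⁻≢i e = l≢τ (trans (sym (τ-τ⁻ l)) (cong τ e))

      spread-edge : ∀ x y → x ≢ y → Edge (spread i base 0ℤ x) (spread i base 1ℤ y) → x ⟶ y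
      spread-edge x y x≢y (rise l p) = proj₂ (spread-Diagonal⁻¹ i base 0ℤ 1ℤ x y p)
      spread-edge x y x≢y (fall l p) with () ← proj₁ (spread-Diagonal⁻¹ i base 1ℤ 0ℤ y x p)
      spread-edge x y x≢y (line l p) = contradiction p (spread-¬Line i base 0ℤ 1ℤ x y (λ ()) x≢y)

    map-at-preserves : Upright → (∀ {x y} → x ⟶ y → ψ x ⟶ ψ y) × (∀ {x y} → ψ x ⟶ ψ y → x ⟶ y)
    map-at-preserves up′ = preserves , reflects
      where
      preserves : ∀ {x y} → x ⟶ y → ψ x ⟶ ψ y
      preserves {x} {y} p = subst₂ _⟶_ (at-spread 0ℤ x) (at-spread 1ℤ y)
        (up′ (spread-Diagonal i base 0ℤ 1ℤ x y refl p) .climb)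

      reflects : ∀ {x y} → ψ x ⟶ ψ y → x ⟶ y
      reflects {x} {y} p = spread-edge x y (λ { refl → ⟶-irrefl p }) (edge⁻¹ (rise (τ i) (mkDiagonal
        (subst₂ _⟶_ (sym (at-spread 0ℤ x)) (sym (at-spread 1ℤ y)) p)
        -- The slides are borrowed from the edge to the parent `up 0 x`; replacing that parent by
        -- `y` alters the image in coordinate `τ i` only.
        (λ l≢τ → trans (off-spread 1ℤ y (up 0 x) l≢τ)
          (up′ (spread-Diagonal i base 0ℤ 1ℤ x (up 0 x) refl (0 , up-Step 0 x)) .slid l≢τ)))))

    map-at-reverses : Inverted → (∀ {x y} → x ⟶ y → ψ y ⟶ ψ x) × (∀ {x y} → ψ x ⟶ ψ y → y ⟶ x)
    map-at-reverses down′ = reverses , reflects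
      where
      reverses : ∀ {x y} → x ⟶ y → ψ y ⟶ ψ x
      reverses {x} {y} p = subst₂ _⟶_ (at-spread 1ℤ y) (at-spread 0ℤ x)
        (down′ (spread-Diagonal i base 0ℤ 1ℤ x y refl p) .climb)

      reflects : ∀ {x y} → ψ x ⟶ ψ y → y ⟶ x
      reflects {x} {y} p = spread-edge y x (λ { refl → ⟶-irrefl p }) (edge⁻¹ (fall (τ i) (mkDiagonal
        (subst₂ _⟶_ (sym (at-spread 1ℤ x)) (sym (at-spread 0ℤ y)) p)
        (λ l≢τ → trans
          (down′ (spread-Diagonal i base 0ℤ 1ℤ y (up 0 y) refl (0 , up-Step 0 y)) .slid l≢τ)
          (cong s (off-spread 1ℤ (up 0 y) x l≢τ))))))

    map-at-⟶ : (∀ {x y} → x ⟶ y → ψ x ⟶ ψ y) × (∀ {x y} → ψ x ⟶ ψ y → x ⟶ y)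
    map-at-⟶ with orientation
    ... | inj₁ up′   = map-at-preserves up′
    ... | inj₂ down′ = let reverses , reflects = map-at-reverses down′ in
      ⊥-elim (not-reversing ψ (map-at⁻ i) (map-at-map-at⁻ i) reverses reflects)

    map-at-Step : ∀ n {x y} → Step n x y → Step n (ψ x) (ψ y)
    map-at-Step = let preserves , reflects = map-at-⟶ in
      preserves-Step ψ (map-at⁻ i) (map-at-map-at⁻ i) preserves reflects

-- Climbing to a fixed point

drop : ℕ → T → T
drop zero    t = t
drop (suc j) t = drop j (σ t)

drop-0 : ∀ j → drop j 0ᵀ ≡ 0ᵀ
drop-0 zero    = refl
drop-0 (suc j) = drop-0 j

drop-all : ∀ t → ∃ λ b → ∀ {j} → b ≤ j → drop j t ≡ 0ᵀ
drop-all 0ᵀ = 0 , λ {j} _ → drop-0 j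
drop-all (nzᵀ (lastᵀ a _)) = 1 , λ { {suc j} (s≤s _) → drop-0 j }
drop-all (nzᵀ (a ∷ᵀ t)) with drop-all (nzᵀ t)
... | b , p = suc b , λ { {suc j} (s≤s b≤j) → p b≤j }

data Climb (n : ℕ) : ℕ → V → V → Set where
  stay : ∀ {x} → Climb n 0 x x
  step : ∀ {j x y z} → Step n x y → Climb n j y z → Climb n (suc j) x z

Climb-map : ∀ {n} (ψ : V → V) → (∀ {x y} → Step n x y → Step n (ψ x) (ψ y)) →
  ∀ {j x y} → Climb n j x y → Climb n j (ψ x) (ψ y)
Climb-map ψ f stay       = stay
Climb-map ψ f (step p c) = step (f p) (Climb-map ψ f c)

climb-up : ℕ → ℕ → V → V
climb-up n zero    x = x
climb-up n (suc j) x = climb-up n j (up n x)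

climb-up-Climb : ∀ n j x → Climb n j x (climb-up n j x)
climb-up-Climb n zero    x = stay
climb-up-Climb n (suc j) x = step (up-Step n x) (climb-up-Climb n j (up n x))

-- Each step bumps level `suc n` of both points equally and deletes one entry of level `n`, so
-- agreement above `n` persists and level `n` agrees once the differing entries are gone.
Climb-merge : ∀ {n j x y x′ y′} → Climb n j x y → Climb n j x′ y′ →
  Agree (suc n) x x′ → drop j (x ! n) ≡ drop j (x′ ! n) → Agree n y y′
Climb-merge {n} stay stay a e = agree λ n≤l →
  [ a .on , (λ { refl → e }) ]′ (ℕ.m≤n⇒m<n∨m≡n n≤l)
Climb-merge {n} {suc j} (step {y = z} p c) (step {y = z′} p′ c′) a e = Climb-merge c c′
  (agree λ n<l → [ (λ h → trans (p .high .on h) (trans (a .on n<l) (sym (p′ .high .on h))))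
                 , (λ { refl → trans (p .mid) (trans (cong S (a .on n<l)) (sym (p′ .mid))) }) ]′
                 (ℕ.m≤n⇒m<n∨m≡n n<l))
  (trans (cong (drop j) (p .low)) (trans e (cong (drop j) (sym (p′ .low)))))

uniform : ∀ {d} (P : Fin d → ℕ → Set) → (∀ i {m n} → m ≤ n → P i m → P i n) →
  (∀ i → ∃ (P i)) → ∃ λ n → ∀ i → P i n
uniform {zero}  P mono f = 0 , λ ()
uniform {suc d} P mono f with f zero | uniform (P ∘ suc) (mono ∘ suc) (f ∘ suc)
... | m , p | n , q = m ⊔ n , λ where
  zero    → mono zero (ℕ.m≤m⊔n m n) p
  (suc i) → mono (suc i) (ℕ.m≤n⊔m m n) (q i)

module _ {d : ℕ} (f : Auto (suc (suc d))) where
  open Auto f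
  open Coordinates f

  fixed-point : ∃ λ u → ⟦ u ⟧ ≡ u
  fixed-point = descend (proj₁ start) base (proj₂ start)
    where
    start = uniform (λ i n → Agree n (lookup (⟦ base ⟧) i) (lookup base i)) (λ _ → Agree-mono)
              (λ i → eventually-agree _ _)

    descend : ∀ n u → (∀ i → Agree n (lookup (⟦ u ⟧) i) (lookup u i)) → ∃ λ u → ⟦ u ⟧ ≡ u
    descend zero    u a = u , lookup-ext _ _ λ i → Agree-0 (a i)
    descend (suc n) u a = descend n v merged
      where
      killed : ∃ λ b → ∀ i → (∀ {j} → b ≤ j → drop j (lookup (⟦ u ⟧) i ! n) ≡ drop j (lookup u i ! n))
      killed = uniform (λ i b → ∀ {j} → b ≤ j → drop j (lookup (⟦ u ⟧) i ! n) ≡ drop j (lookup u i ! n))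
        (λ i m≤n p n≤j → p (ℕ.≤-trans m≤n n≤j))
        λ i → let b , p = drop-all (lookup (⟦ u ⟧) i ! n)
                  c , q = drop-all (lookup u i ! n)
              in b ⊔ c , λ h → trans (p (ℕ.≤-trans (ℕ.m≤m⊔n b c) h)) (sym (q (ℕ.≤-trans (ℕ.m≤n⊔m b c) h)))

      -- One `J` serves all coordinates: coordinate `l` of the image follows the climb of coordinate
      -- `τ⁻ l` of `u`, which must be as long as that of coordinate `l`.
      J = proj₁ killed
      v = Data.Vec.map (climb-up n J) u

      climbs : ∀ i → Climb n J (lookup u i) (lookup v i)
      climbs i = subst (Climb n J (lookup u i)) (sym (Vec.lookup-map i (climb-up n J) u))
                   (climb-up-Climb n J (lookup u i))

      image : ∀ i → Climb n J (lookup (⟦ u ⟧) (τ i)) (lookup (⟦ v ⟧) (τ i))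
      image i = subst₂ (Climb n J) (sym (component≡ i u)) (sym (component≡ i v))
                  (Climb-map (map-at i) (map-at-Step i n) (climbs i))

      merged : ∀ l → Agree n (lookup (⟦ v ⟧) l) (lookup v l)
      merged l = Climb-merge
        (subst (λ l → Climb n J (lookup (⟦ u ⟧) l) (lookup (⟦ v ⟧) l)) (τ-τ⁻ l) (image (τ⁻ l)))
        (climbs l) (a l) (proj₂ killed l ℕ.≤-refl)

-- The graph and its vertex transitivity

Edge-irrefl : ∀ {d} {u v : Vec V d} → u ≡ v → ¬ Edge u v
Edge-irrefl refl (line i p) = p .change refl
Edge-irrefl refl (rise i p) = ⟶-irrefl (p .climb)
Edge-irrefl refl (fall i p) = ⟶-irrefl (p .climb)

graph : ℕ → Graph
graph d = record
  { V        = Vec V d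
  ; E        = Edge
  ; E-sym    = Edge-sym
  ; E-irrefl = Edge-irrefl
  }

auto : ∀ {d} → Automorphism (graph d) → Auto d
auto {d} φ = record
  { ⟦_⟧ = to ; ⟦_⟧⁻ = to⁻ ; ⟦⟧-⟦⟧⁻ = to-to⁻
  ; ⟦⟧⁻-⟦⟧ = λ u → Bijection.injective bijection (to-to⁻ (to u))
  ; edge = λ {u} {v} → Equivalence.to (preserves u v)
  ; edge⁻ = λ {u} {v} e → Equivalence.from (preserves _ _)
      (subst₂ Edge (sym (to-to⁻ u)) (sym (to-to⁻ v)) e)
  }
  where
  open Automorphism φ
  to⁻ : Vec V d → Vec V d
  to⁻ v = proj₁ (Bijection.strictlySurjective bijection v)
  to-to⁻ : ∀ v → to (to⁻ v) ≡ v
  to-to⁻ v = proj₂ (Bijection.strictlySurjective bijection v)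

module _ {d} (f : Fin d → Symmetry) where

  coordinatewise coordinatewise⁻ : Vec V d → Vec V d
  coordinatewise  u = tabulate λ i → f i .apply (lookup u i)
  coordinatewise⁻ u = tabulate λ i → f i .unapply (lookup u i)

  coordinatewise-edge : ∀ {u v} → Edge u v → Edge (coordinatewise u) (coordinatewise v)
  coordinatewise-edge {u} {v} = λ where
      (line i p) → line i (mkLine
        (λ e → p .change (trans (sym (f i .unapply-apply _)) (trans (cong (f i .unapply)
          (trans (sym (at u i)) (trans e (at v i)))) (f i .unapply-apply _))))
        (λ {j} j≢i → trans (at v j) (trans (cong (f j .apply) (p .same j≢i)) (sym (at u j)))))
      (rise i p) → rise i (diagonal u v p)
      (fall i p) → fall i (diagonal v u p)
    where
    at : ∀ u i → lookup (coordinatewise u) i ≡ f i .apply (lookup u i)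
    at u = Vec.lookup∘tabulate _

    diagonal : ∀ u v {i} → Diagonal i u v → Diagonal i (coordinatewise u) (coordinatewise v)
    diagonal u v {i} p = mkDiagonal
      (subst₂ _⟶_ (sym (at u i)) (sym (at v i)) (f i .apply-⟶ (p .climb)))
      (λ {j} j≢i → trans (at v j) (trans (cong (f j .apply) (p .slid j≢i))
        (trans (f j .apply-s _) (cong s (sym (at u j))))))

  coordinatewise⁻-coordinatewise : ∀ u → coordinatewise⁻ (coordinatewise u) ≡ u
  coordinatewise⁻-coordinatewise u = lookup-ext _ u λ i →
    trans (Vec.lookup∘tabulate _ i) (trans (cong (f i .unapply) (Vec.lookup∘tabulate _ i)) (f i .unapply-apply _))

module _ {d} (f : Fin d → Symmetry) where

  private
    g : Fin d → Symmetry
    g = inverse ∘ f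

    back : ∀ u → coordinatewise f (coordinatewise g u) ≡ u
    back = coordinatewise⁻-coordinatewise g

  automorphism : Automorphism (graph d)
  automorphism = record
    { bijection = mk⤖ {to = coordinatewise f}
        ( (λ {u} {v} e → trans (sym (forth u)) (trans (cong (coordinatewise g) e) (forth v)))
        , λ v → coordinatewise g v , λ { refl → back v })
    ; preserves = λ u v → mk⇔ (coordinatewise-edge f)
        (λ e → subst₂ Edge (forth u) (forth v) (coordinatewise-edge g e))
    }
    where
    forth : ∀ u → coordinatewise g (coordinatewise f u) ≡ u
    forth = coordinatewise⁻-coordinatewise f

vertex-transitive : ∀ d → VertexTransitive (graph d)
vertex-transitive d u v = automorphism (λ i → proj₁ (moves i)) , lookup-ext _ v λ i →
  trans (Vec.lookup∘tabulate _ i) (proj₂ (moves i))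
  where
  moves : ∀ i → ∃ λ f → apply f (lookup u i) ≡ lookup v i
  moves i = transitive (lookup u i) (lookup v i)

-- Cardinality

code : ∀ d → PrefixCode (Vec V d)
code d = Vec-code d (FinSupp-code (FinSupp-code ℤ-code))

infinite : ∀ d → InfiniteGraph (graph (suc d))
infinite d = mk↣ {to = λ n → replicate _ (slide (+ n) 0ⱽ)} λ {m} {n} e →
  ℤ.+-injective (slide-injective (+ m) (+ n) 0ⱽ (cong Data.Vec.head e))

-- Diameter

data Walk {d} : ℕ → Vec V d → Vec V d → Set where
  []  : ∀ {u} → Walk 0 u u
  _∷_ : ∀ {n u v w} → Edge u v → Walk n v w → Walk (suc n) u w

walk⇒path : ∀ {d n} {u v : Vec V d} → Walk n u v → Path (graph d) n u v
walk⇒path {u = u} [] = record { vertex = λ _ → u ; edge = λ () ; start = refl ; end = refl }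
walk⇒path {u = u} (e ∷ w) = record
  { vertex = λ { zero → u ; (suc i) → p .vertex i }
  ; edge   = λ { zero → subst (Edge u) (sym (p .start)) e ; (suc i) → p .edge i }
  ; start  = refl
  ; end    = p .end
  }
  where
  open Path
  p = walk⇒path w

Line-cons : ∀ {d a} {i : Fin d} {u v} → Line i u v → Line (suc i) (a ∷ u) (a ∷ v)
Line-cons {a = a} {i} {u} {v} p = mkLine (p .change) same′
  where
  same′ : ∀ {j} → j ≢ suc i → lookup (a ∷ v) j ≡ lookup (a ∷ u) j
  same′ {zero}  _   = refl
  same′ {suc j} j≢i = p .same (j≢i ∘ cong suc)

-- Line edges survive putting a fixed coordinate in front, whereas a diagonal edge would have to
-- slide that coordinate.
data LineWalk {d} : ℕ → Vec V d → Vec V d → Set where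
  []  : ∀ {u} → LineWalk 0 u u
  _∷_ : ∀ {n i u v w} → Line i u v → LineWalk n v w → LineWalk (suc n) u w

LineWalk-cons : ∀ {d n a} {u v : Vec V d} → LineWalk n u v → LineWalk n (a ∷ u) (a ∷ v)
LineWalk-cons []      = []
LineWalk-cons (p ∷ w) = Line-cons p ∷ LineWalk-cons w

forget : ∀ {d n} {u v : Vec V d} → LineWalk n u v → Walk n u v
forget []      = []
forget (p ∷ w) = line _ p ∷ forget w

line-walk : ∀ {d} (u v : Vec V d) → ∃ λ n → n ≤ d × LineWalk n u v
line-walk [] [] = 0 , z≤n , []
line-walk (a ∷ u) (b ∷ v) with line-walk u v | a ≟ⱽ b
... | n , n≤d , w | yes refl = n , ℕ.m≤n⇒m≤1+n n≤d , LineWalk-cons w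
... | n , n≤d , w | no a≢b   = suc n , s≤s n≤d , mkLine {i = zero} a≢b same′ ∷ LineWalk-cons w
  where
  same′ : ∀ {j} → j ≢ zero → lookup (b ∷ u) j ≡ lookup (a ∷ u) j
  same′ {zero}  j≢0 = contradiction refl j≢0
  same′ {suc j} _   = refl

within : ∀ d → ConnectedWithin (graph d) d
within d u v = let n , n≤d , w = line-walk u v in n , n≤d , walk⇒path (forget w)

axis-of : ∀ {d} {u v : Vec V d} → Edge u v →
  ∃ λ i → ∀ {j} → j ≢ i → Agree 1 (lookup u j) (lookup v j)
axis-of (line i p) = i , λ j≢i → subst (Agree 1 _) (sym (p .same j≢i)) Agree-refl
axis-of (rise i p) = i , rise-Skew p .agrees
axis-of (fall i p) = i , fall-Skew p .agrees

module _ {d n} {u v : Vec V d} (path : Path (graph d) n u v)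
         (far : ∀ i → ¬ Agree 1 (lookup u i) (lookup v i)) where
  open Path path

  private
    axes : Fin n → Fin d
    axes i = proj₁ (axis-of (edge i))

    unmoved : ∀ {m} (x : Fin (suc m) → Vec V d) j →
      (∀ i → Agree 1 (lookup (x (inject₁ i)) j) (lookup (x (suc i)) j)) →
      Agree 1 (lookup (x zero) j) (lookup (x (fromℕ m)) j)
    unmoved {zero}  x j a = Agree-refl
    unmoved {suc m} x j a = Agree-trans (a zero) (unmoved (x ∘ suc) j (a ∘ suc))

    moved : ∀ j → ∃ λ i → axes i ≡ j
    moved j with Fin.any? (λ i → axes i Fin.≟ j)
    ... | yes p = p
    ... | no ¬p = contradiction
      (subst₂ (λ x y → Agree 1 (lookup x j) (lookup y j)) start end
        (unmoved vertex j λ i → proj₂ (axis-of (edge i)) λ e → ¬p (i , sym e)))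
      (far j)

  -- Every coordinate is the axis of some edge of the path, and choosing such an edge for each
  -- coordinate is injective.
  length≥ : d ≤ n
  length≥ = Fin.injective⇒≤ {f = proj₁ ∘ moved} λ {i} {j} e →
    trans (sym (proj₂ (moved i))) (trans (cong axes e) (proj₂ (moved j)))

has-diameter : ∀ d → HasDiameter (graph d) d
has-diameter d = within d , λ m c →
  -- These two vertices differ at level 1 in every coordinate, so a path between them needs an edge
  -- for each.
  let n , n≤m , path = c (replicate d 0ⱽ) (replicate d (up 0 0ⱽ))
  in ℕ.≤-trans (length≥ path far) n≤m
  where
  far : ∀ i → ¬ Agree 1 (lookup (replicate d 0ⱽ) i) (lookup (replicate d (up 0 0ⱽ)) i)
  far i a = ⟶-disagree (0 , up-Step 0 0ⱽ)
    (subst₂ (Agree 1) (Vec.lookup-replicate i 0ⱽ) (Vec.lookup-replicate i (up 0 0ⱽ)) a)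

theorem1p3 : (k : ℕ) → 2 ≤ k →
    ∃ λ (G : Graph) →
    InfiniteGraph G
    × CountablyManyVertices G
    × StronglyRotarilyTransitive G
    × Connected G
    × HasDiameter G k
theorem1p3 (suc (suc d)) (s≤s (s≤s z≤n)) =
  graph (suc (suc d))
  , infinite (suc d)
  , code⇒↣ (code (suc (suc d)))
  , (vertex-transitive (suc (suc d)) , λ φ → fixed-point (auto φ))
  , (λ u v → let n , _ , p = within (suc (suc d)) u v in n , p)
  , has-diameter (suc (suc d))
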